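{- Let $\varepsilon>0$. Let $(G,\sigma)$ be a finite connected signed graph satisfying $CD^{\sigma}(K,N)$ with $K\in\mathbb{R}$ and $N\in(0,\infty]$ such that $N>\frac{4}{(2+\varepsilon)^2}$, and let $\lambda^{\sigma}$ be a nonzero eigenvalue of $\Delta^\sigma$. Then \[ \lambda^{\sigma}\geq\frac{\varepsilon}{(2+\varepsilon)^{2}-\frac{4}{N}}\cdot\frac{1}{d(D+1)\lceil (D+1)/2\rceil}+\frac{2(2+\varepsilon)}{(2+\varepsilon)^{2}-\frac{4}{N}}K, \] where $d$ is the maximal vertex degree and $D$ the diameter of $G$. Moreover, if the multiplicity of $\lambda^\sigma$ is at least $2$ or $(G,\sigma)$ is balanced, then \[ \lambda^{\sigma}\geq\frac{\varepsilon}{(2+\varepsilon)^{2}-\frac{4}{N}}\cdot\frac{1}{dD\lceil D/2\rceil}+\frac{2(2+\varepsilon)}{(2+\varepsilon)^{2}-\frac{4}{N}}K. \] (Convention $\frac1N=0$ if $N=\infty$.)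
   Context: $G=(V,E)$ is a finite simple connected graph with degrees $d_x$; $\sigma:E\to\{\pm1\}$, $\sigma_{xy}=\sigma(\{x,y\})$. $(G,\sigma)$ is balanced if the product of signs along every cycle is $+1$. Signed Laplacian $\Delta^{\sigma}f(x)=\frac{1}{d_x}\sum_{y\sim x}(\sigma_{xy}f(y)-f(x))$; $\Delta$ is the case $\sigma\equiv+1$; $\lambda$ is an eigenvalue of $\Delta^\sigma$ if $-\Delta^\sigma f=\lambda f$ for some nonzero $f$. $\Gamma^{\sigma}(f,g)=\frac12\{\Delta(fg)-g\Delta^{\sigma}f-f\Delta^{\sigma}g\}$, $\Gamma_2^{\sigma}(f,g)=\frac12\{\Delta\Gamma^{\sigma}(f,g)-\Gamma^{\sigma}(g,\Delta^{\sigma}f)-\Gamma^{\sigma}(f,\Delta^{\sigma}g)\}$. $CD^{\sigma}(K,N)$ means $\Gamma_2^{\sigma}(f,f)(x)\ge\frac1N(\Delta^\sigma f)^2(x)+K\Gamma^\sigma(f,f)(x)$ for all $f:V\to\mathbb{R}$ and all $x\in V$. $\lceil\cdot\rceil$ is the ceiling function. -}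

module Defs where

open import Level using (Level; 0ℓ; _⊔_) renaming (suc to lsuc)
open import Algebra.Apartness.Bundles using (HeytingField)
import Algebra.Apartness.Properties.HeytingCommutativeRing as HeytingProperties
open import Algebra.Bundles using (CommutativeRing)
import Algebra.Definitions.RawMonoid as RawMonoidDefs
import Algebra.Properties.Ring as RingProperties
open import Data.Empty using (⊥-elim)
open import Data.Fin.Base using (Fin)
open import Data.List.Base using (List; []; _∷_; allFin; filter; foldr; length; map)
open import Data.List.Extrema.Nat using (max)
open import Data.List.Relation.Unary.Unique.Propositional using (Unique)
open import Data.Nat.Base as ℕ using (ℕ; zero; suc)
open import Data.Product.Base using (∃; ∃-syntax; _×_; _,_; proj₁; proj₂)
open import Data.Sign.Base as Sign using (Sign)
open import Data.Sum.Base using (_⊎_; inj₁; inj₂)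
open import Data.Unit.Polymorphic.Base using (⊤)
open import Function.Bundles using (_⇔_; Equivalence)
open import Relation.Binary.Core using (Rel)
open import Relation.Binary.Definitions using (Decidable; Irreflexive; Symmetric)
open import Relation.Binary.PropositionalEquality.Core using (_≡_)
open import Relation.Binary.Structures using (IsStrictPartialOrder)
open import Relation.Nullary.Negation using (¬_)

-- A Cauchy-complete Archimedean ordered field. Classically this
-- determines ℝ up to a unique isomorphism. Decidability of the order is
-- not assumed, so that the usual constructive reals qualify as well.

record RealNumbers (c ℓ₁ ℓ₂ : Level) : Set (lsuc (c ⊔ ℓ₁ ⊔ ℓ₂)) where
  field
    heytingField : HeytingField c ℓ₁ ℓ₂

  open HeytingField heytingField public renaming (Carrier to ℝ)

  commutativeRing : CommutativeRing c ℓ₁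
  commutativeRing = record { isCommutativeRing = isCommutativeRing }

  open RawMonoidDefs (CommutativeRing.+-rawMonoid commutativeRing)
    using () renaming (_×_ to _×ℕ_)

  fromℕ : ℕ → ℝ
  fromℕ n = n ×ℕ 1#

  infix 4 _<_ _≤_

  field
    _<_                  : Rel ℝ ℓ₂
    isStrictPartialOrder : IsStrictPartialOrder _≈_ _<_
    #⇔<⊎>                : ∀ {x y} → x # y ⇔ (x < y ⊎ y < x)
    +-monoˡ-<            : ∀ z {x y} → x < y → x + z < y + z
    *-pos                : ∀ {x y} → 0# < x → 0# < y → 0# < x * y

  open IsStrictPartialOrder isStrictPartialOrder public
    using (<-resp-≈; <-respˡ-≈; <-respʳ-≈)
    renaming (irrefl to <-irrefl; trans to <-trans)

  -- The product x * fromℕ (suc k) < 1# expresses x < 1/(k+1).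
  field
    archimedean : ∀ x → ∃[ n ] x < fromℕ n
    complete    : (u : ℕ → ℝ) →
                  (∀ k → ∃[ M ] ∀ i j → M ℕ.≤ i → M ℕ.≤ j →
                    (u i - u j) * fromℕ (suc k) < 1#) →
                  ∃[ l ] ∀ k → ∃[ M ] ∀ i → M ℕ.≤ i →
                    (u i - l) * fromℕ (suc k) < 1# ×
                    (l - u i) * fromℕ (suc k) < 1#

  -- The usual order of the constructive reals, equivalent to x < y ⊎ x ≈ y
  -- when < is decidable.
  _≤_ : Rel ℝ ℓ₂
  x ≤ y = ¬ (y < x)

  private
    module HP = HeytingProperties heytingCommutativeRing
    module RP = RingProperties (CommutativeRing.ring commutativeRing)

  x<y⇒0<y-x : ∀ {x y} → x < y → 0# < y - x
  x<y⇒0<y-x {x} x<y = <-respˡ-≈ (-‿inverseʳ x) (+-monoˡ-< (- x) x<y)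

  0<y-x⇒x<y : ∀ {x y} → 0# < y - x → x < y
  0<y-x⇒x<y {x} {y} p =
    <-respʳ-≈ (trans (+-assoc y (- x) x)
                (trans (+-congˡ (-‿inverseˡ x)) (+-identityʳ y)))
      (<-respˡ-≈ (+-identityˡ x) (+-monoˡ-< x p))

  *-monoˡ-<-pos : ∀ {x y z} → 0# < z → x < y → x * z < y * z
  *-monoˡ-<-pos {x} {y} {z} 0<z x<y = 0<y-x⇒x<y
    (<-respʳ-≈ (RP.[y-z]x≈yx-zx z y x) (*-pos (x<y⇒0<y-x x<y) 0<z))

  +-pos : ∀ {x y} → 0# < x → 0# < y → 0# < x + y
  +-pos {x} {y} 0<x 0<y =
    <-trans 0<y (<-respˡ-≈ (+-identityˡ y) (+-monoˡ-< y 0<x))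

  0<1 : 0# < 1#
  0<1 with Equivalence.to #⇔<⊎> HP.1#0
  ... | inj₂ 0<1# = 0<1#
  ... | inj₁ 1<0  = ⊥-elim (<-irrefl refl (<-trans 1<0 0<[-1]²))
    where
    0<-1 : 0# < - 1#
    0<-1 = <-respʳ-≈ (+-identityˡ (- 1#)) (x<y⇒0<y-x 1<0)

    0<[-1]² : 0# < 1#
    0<[-1]² = <-respʳ-≈ (trans (RP.-1*x≈-x (- 1#)) (RP.-‿involutive 1#))
                (*-pos 0<-1 0<-1)

  fromℕ-pos : ∀ n → 0# < fromℕ (suc n)
  fromℕ-pos zero    = <-respʳ-≈ (sym (+-identityʳ 1#)) 0<1
  fromℕ-pos (suc n) = +-pos 0<1 (fromℕ-pos n)

  recip : ∀ x → 0# < x → ℝ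
  recip x 0<x =
    proj₁ (#⇒invertible {x} {0#} (Equivalence.from #⇔<⊎> (inj₂ 0<x)))

  recip-inverse : ∀ x (p : 0# < x) → x * recip x p ≈ 1#
  recip-inverse x p =
    trans (*-congʳ (sym (HP.x-0≈x x)))
      (proj₂ (proj₂ (#⇒invertible {x} {0#} (Equivalence.from #⇔<⊎> (inj₂ p)))))

  recip-pos : ∀ x (p : 0# < x) → 0# < recip x p
  recip-pos x p with Equivalence.to #⇔<⊎> r#0
    where
    r#0 : recip x p # 0#
    r#0 = HP.invertibleˡ⇒#
      (x , trans (*-congˡ (HP.x-0≈x _)) (recip-inverse x p))
  ... | inj₂ 0<r = 0<r
  ... | inj₁ r<0 = ⊥-elim (<-irrefl refl (<-trans 0<1 1<0))
    where
    1<0 : 1# < 0#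
    1<0 = <-respʳ-≈ (zeroˡ x)
      (<-respˡ-≈ (trans (*-comm _ x) (recip-inverse x p))
        (*-monoˡ-<-pos p r<0))

  infixl 7 _/_⟨_⟩

  _/_⟨_⟩ : ∀ (x y : ℝ) → 0# < y → ℝ
  x / y ⟨ p ⟩ = x * recip y p

  -- The value at 0 is a junk value: it is met only for the degree, maximal
  -- degree and diameter of a one-vertex graph, whose Laplacian (an empty
  -- sum) has no nonzero eigenvalue.
  1/ℕ_ : ℕ → ℝ
  1/ℕ zero    = 0#
  1/ℕ (suc n) = recip (fromℕ (suc n)) (fromℕ-pos n)

  ½ : ℝ
  ½ = 1/ℕ 2

  infix 9 _²

  _² : ℝ → ℝ
  x ² = x * x

  data ⟨0,∞] : Set (c ⊔ ℓ₂) where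
    fin : ∀ N → 0# < N → ⟨0,∞]
    ∞   : ⟨0,∞]

  infix 4 _<∞_

  _<∞_ : ℝ → ⟨0,∞] → Set ℓ₂
  x <∞ fin N _ = x < N
  x <∞ ∞       = ⊤

  1/∞_ : ⟨0,∞] → ℝ
  1/∞ fin N 0<N = recip N 0<N
  1/∞ ∞         = 0#

  [2+_]² : ℝ → ℝ
  [2+ ε ]² = (fromℕ 2 + ε) ²

  [2+ε]²-pos : ∀ {ε} → 0# < ε → 0# < [2+ ε ]²
  [2+ε]²-pos 0<ε = *-pos 0<2+ε 0<2+ε
    where 0<2+ε = +-pos (fromℕ-pos 1) 0<ε

  [2+_]²-4/_ : ℝ → ⟨0,∞] → ℝ
  [2+ ε ]²-4/ N = [2+ ε ]² - fromℕ 4 * 1/∞ N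

  [2+ε]²-4/N-pos : ∀ {ε} (0<ε : 0# < ε) (N : ⟨0,∞]) →
                   fromℕ 4 / [2+ ε ]² ⟨ [2+ε]²-pos 0<ε ⟩ <∞ N →
                   0# < [2+ ε ]²-4/ N
  [2+ε]²-4/N-pos {ε} 0<ε ∞ _ = <-respʳ-≈
    (sym (trans (+-congˡ (trans (-‿cong (zeroʳ (fromℕ 4))) RP.-0#≈0#))
                (+-identityʳ _)))
    ([2+ε]²-pos 0<ε)
  [2+ε]²-4/N-pos {ε} 0<ε (fin N 0<N) 4/a<N = x<y⇒0<y-x
    (<-respʳ-≈ Na/N≈a (*-monoˡ-<-pos (recip-pos N 0<N) 4<Na))
    where
    a : ℝ
    a = [2+ ε ]²

    0<a : 0# < a
    0<a = [2+ε]²-pos 0<ε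

    4<Na : fromℕ 4 < N * a
    4<Na = <-respˡ-≈
      (trans (*-assoc _ _ a)
        (trans (*-congˡ (trans (*-comm _ a) (recip-inverse a 0<a)))
               (*-identityʳ _)))
      (*-monoˡ-<-pos 0<a 4/a<N)

    Na/N≈a : N * a * recip N 0<N ≈ a
    Na/N≈a = trans (*-congʳ (*-comm N a))
      (trans (*-assoc a N _)
        (trans (*-congˡ (recip-inverse N 0<N)) (*-identityʳ a)))

record Graph (n : ℕ) : Set₁ where
  infix 4 _∼_ _∼?_
  field
    _∼_      : Rel (Fin n) 0ℓ
    _∼?_     : Decidable _∼_
    ∼-sym    : Symmetric _∼_
    ∼-irrefl : Irreflexive _≡_ _∼_

  neighbours : Fin n → List (Fin n)
  neighbours x = filter (x ∼?_) (allFin n)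

  deg : Fin n → ℕ
  deg x = length (neighbours x)

  maxDegree : ℕ
  maxDegree = max 0 (map deg (allFin n))

  infixr 5 _∷_

  data Walk : Fin n → Fin n → ℕ → Set where
    []  : ∀ {x} → Walk x x 0
    _∷_ : ∀ {x y z k} → x ∼ y → Walk y z k → Walk x z (suc k)

  -- The final vertex is omitted, so that for a closed walk Unique (starts w)
  -- says that no vertex other than the base point is revisited, and that the
  -- base point is met only at the two ends.
  starts : ∀ {x y k} → Walk x y k → List (Fin n)
  starts         []      = []
  starts {x = x} (_ ∷ w) = x ∷ starts w

  IsCycle : ∀ {x k} → Walk x x k → Set
  IsCycle {k = k} w = 3 ℕ.≤ k × Unique (starts w)

  Connected : Set
  Connected = ∀ x y → ∃ (Walk x y)

  IsDistance : Fin n → Fin n → ℕ → Set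
  IsDistance x y k = Walk x y k × (∀ m → Walk x y m → k ℕ.≤ m)

  IsDiameter : ℕ → Set
  IsDiameter D = (∃[ x ] ∃[ y ] IsDistance x y D) ×
                 (∀ x y k → IsDistance x y k → k ℕ.≤ D)

-- The sign function is defined on all pairs of vertices, but only its
-- values on edges are ever used.

record SignedGraph (n : ℕ) : Set₁ where
  field
    graph : Graph n

  open Graph graph public

  field
    σ     : Fin n → Fin n → Sign
    σ-sym : ∀ {x y} → x ∼ y → σ x y ≡ σ y x

  walkSign : ∀ {x y k} → Walk x y k → Sign
  walkSign []                        = Sign.+
  walkSign (_∷_ {x = x} {y = y} _ w) = σ x y Sign.* walkSign w

  Balanced : Set
  Balanced = ∀ {x k} (w : Walk x x k) → IsCycle w → walkSign w ≡ Sign.+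

module SignedLaplacian {c ℓ₁ ℓ₂ : Level} (R : RealNumbers c ℓ₁ ℓ₂)
                       {n : ℕ} (G : SignedGraph n) where
  open RealNumbers R
  open SignedGraph G

  Function : Set c
  Function = Fin n → ℝ

  _·_ : Sign → ℝ → ℝ
  Sign.+ · r = r
  Sign.- · r = - r

  ∑ : List ℝ → ℝ
  ∑ = foldr _+_ 0#

  laplacian : (Fin n → Fin n → Sign) → Function → Function
  laplacian τ f x =
    1/ℕ (deg x) * ∑ (map (λ y → (τ x y · f y) - f x) (neighbours x))

  Δσ : Function → Function
  Δσ = laplacian σ

  Δ : Function → Function
  Δ = laplacian (λ _ _ → Sign.+)

  Γσ : Function → Function → Function
  Γσ f g x = ½ * (Δ (λ y → f y * g y) x - g x * Δσ f x - f x * Δσ g x)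

  Γ₂σ : Function → Function → Function
  Γ₂σ f g x = ½ * (Δ (Γσ f g) x - Γσ g (Δσ f) x - Γσ f (Δσ g) x)

  CDσ : ℝ → ⟨0,∞] → Set (c ⊔ ℓ₂)
  CDσ K N = ∀ f x → 1/∞ N * Δσ f x ² + K * Γσ f f x ≤ Γ₂σ f f x

  IsEigenfunction : ℝ → Function → Set ℓ₁
  IsEigenfunction μ f = ∀ x → - Δσ f x ≈ μ * f x

  IsEigenvalue : ℝ → Set (c ⊔ ℓ₁)
  IsEigenvalue μ = ∃[ f ] IsEigenfunction μ f × ¬ (∀ x → f x ≈ 0#)

  LinearlyIndependent : ∀ {m} → (Fin m → Function) → Set (c ⊔ ℓ₁)
  LinearlyIndependent {m} fs =
    ∀ (a : Fin m → ℝ) →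
    (∀ x → ∑ (map (λ i → a i * fs i x) (allFin m)) ≈ 0#) →
    ∀ i → a i ≈ 0#

  -- Geometric multiplicity; it agrees with the algebraic one because Δσ is
  -- self-adjoint for the degree-weighted inner product.
  Multiplicity≥ : ℕ → ℝ → Set (c ⊔ ℓ₁)
  Multiplicity≥ m μ =
    ∃[ fs ] (∀ (i : Fin m) → IsEigenfunction μ (fs i)) × LinearlyIndependent fs

{-# OPTIONS --safe #-}
module Submission where

-- Put A = (2+ε)λ − 2K and F = 2Γ(f) + A f² for an eigenfunction f. At a
-- maximum of F, ΔF ≤ 0 and the curvature condition give the gradient estimate
-- ε · 2Γ(f) ≤ P max f², where P = ((2+ε)² − 4/N)λ − 2(2+ε)K; here A ≥ 0
-- because K ≤ λ, by the maximum principle for Γ(f). Let |f| be maximal at v,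
-- and take a walk from x to v of length at most L whose sign s satisfies s
-- f(x) f(v) ≤ 0. Then f(v)² ≤ (f(x) − s f(v))², and Cauchy–Schwarz along the
-- walk bounds this by L times the sum of the squared differences. The two
-- edges at every second vertex of a non-backtracking walk are controlled by
-- Γ(f) at that vertex, so the sum is at most d⌈L/2⌉ max 2Γ(f), whence ε ≤ d L
-- ⌈L/2⌉ P.
--
-- Such a walk exists with L = D if f vanishes somewhere, which can be arranged
-- when the multiplicity is at least 2. In general, if there is none with L = D
-- + 1 (with L = D in the balanced case), the signs of walks of length at most
-- D switch f to a positive eigenfunction of Δ for λ > 0, against the minimum
-- principle.
--
-- Every inequality proved is a negation, so maxima and case distinctions on
-- the order of ℝ are available under a double negation.

open import Defs
open import Algebra.Bundles using (CommutativeRing)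
import Algebra.Properties.AbelianGroup as AbelianGroupProperties
import Algebra.Properties.Monoid.Mult as MonoidMult
import Algebra.Properties.Ring as RingProperties
import Algebra.Properties.Semiring.Mult as SemiringMult
import Algebra.Solver.Ring as RingSolver
open import Algebra.Solver.Ring.AlmostCommutativeRing using (fromCommutativeRing; _-Raw-AlmostCommutative⟶_)
open import Data.Empty using (⊥-elim)
open import Data.Fin.Base as Fin using (Fin)
import Data.Fin.Properties as Fin
open import Data.Integer.Base as ℤ using (ℤ; +_; -[1+_])
import Data.Integer.Properties as ℤ
open import Data.List.Base using (List; []; _∷_; allFin; length; map)
open import Data.List.Extrema.Nat using (xs≤max)
import Data.List.Membership.DecPropositional as DecMembership
open import Data.List.Membership.Propositional using (_∈_)
open import Data.List.Membership.Propositional.Properties using (∈-allFin; ∈-filter⁺; ∈-filter⁻; ∈-map⁺)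
import Data.List.Relation.Unary.All as All
open import Data.List.Relation.Unary.All.Properties using (¬Any⇒All¬)
open import Data.List.Relation.Unary.AllPairs using ([]; _∷_)
open import Data.List.Relation.Unary.Any using (here; there)
open import Data.List.Relation.Unary.Unique.Propositional using (Unique)
import Data.Maybe.Base as Maybe
open Maybe using (Maybe)
open import Data.Nat using (ℕ; zero; suc; z≤n; s≤s; ⌈_/2⌉) renaming (_*_ to _*ℕ_)
import Data.Nat.Base as ℕ
open import Data.Nat.Induction using (<-rec)
import Data.Nat.Properties as ℕ
open import Data.Product using (∃; ∃-syntax; _×_; _,_; proj₁; proj₂)
open import Data.Sign.Base as Sign using (Sign)
import Data.Sign.Properties as Sign
open import Data.Sum using (_⊎_; inj₁; inj₂)
open import Data.Unit.Base using (⊤; tt)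
open import Function.Bundles using (Equivalence)
open import Relation.Binary.Bundles using (Poset)
open import Relation.Binary.PropositionalEquality as ≡ using (_≡_; _≢_)
import Relation.Binary.Reasoning.PartialOrder as PosetReasoning
import Relation.Binary.Reasoning.Setoid as SetoidReasoning
open import Relation.Nullary using (¬_)
open import Relation.Nullary.Decidable using (dec⇒maybe; yes; no)

-- Arithmetic of the real field and its ring solver.

module OrderedField {c ℓ₁ ℓ₂} (R : RealNumbers c ℓ₁ ℓ₂) where
  open RealNumbers R

  private
    open CommutativeRing commutativeRing using (ring; semiring; +-abelianGroup; +-monoid)
    module RP = RingProperties ring
    module AG = AbelianGroupProperties +-abelianGroup
    module MM = MonoidMult +-monoid
    module SM = SemiringMult semiring

  signed : Sign → ℝ → ℝ
  signed Sign.+ x = x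
  signed Sign.- x = - x

  fromℤ : ℤ → ℝ
  fromℤ (+ n)    = fromℕ n
  fromℤ -[1+ n ] = - fromℕ (suc n)

  fromℕ-+ : ∀ m n → fromℕ (m ℕ.+ n) ≈ fromℕ m + fromℕ n
  fromℕ-+ = MM.×-homo-+ 1#

  fromℕ-* : ∀ m n → fromℕ (m ℕ.* n) ≈ fromℕ m * fromℕ n
  fromℕ-* = SM.×1-homo-*

  private
    open SetoidReasoning setoid

    fromℤ-⊖ : ∀ m n → fromℤ (m ℤ.⊖ n) ≈ fromℕ m - fromℕ n
    fromℤ-⊖ zero    zero    = sym (-‿inverseʳ 0#)
    fromℤ-⊖ zero    (suc n) = sym (+-identityˡ _)
    fromℤ-⊖ (suc m) zero    = sym (trans (+-congˡ RP.-0#≈0#) (+-identityʳ _))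
    fromℤ-⊖ (suc m) (suc n) = begin
      fromℤ (suc m ℤ.⊖ suc n)                       ≡⟨ ≡.cong fromℤ (ℤ.[1+m]⊖[1+n]≡m⊖n m n) ⟩
      fromℤ (m ℤ.⊖ n)                               ≈⟨ fromℤ-⊖ m n ⟩
      fromℕ m - fromℕ n                             ≈⟨ +-congʳ (AG.xyx⁻¹≈y 1# (fromℕ m)) ⟨
      1# + fromℕ m - 1# - fromℕ n                   ≈⟨ +-assoc _ _ _ ⟩
      1# + fromℕ m + (- 1# - fromℕ n)               ≈⟨ +-congˡ (AG.⁻¹-∙-comm 1# (fromℕ n)) ⟩
      1# + fromℕ m - (1# + fromℕ n)                 ∎

    fromℤ-+ : ∀ i j → fromℤ (i ℤ.+ j) ≈ fromℤ i + fromℤ j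
    fromℤ-+ (+ m)    (+ n)    = fromℕ-+ m n
    fromℤ-+ (+ m)    -[1+ n ] = fromℤ-⊖ m (suc n)
    fromℤ-+ -[1+ m ] (+ n)    = trans (fromℤ-⊖ n (suc m)) (+-comm _ _)
    fromℤ-+ -[1+ m ] -[1+ n ] = begin
      - fromℕ (suc (suc (m ℕ.+ n)))         ≡⟨ ≡.cong (λ k → - fromℕ (suc k)) (≡.sym (ℕ.+-suc m n)) ⟩
      - fromℕ (suc m ℕ.+ suc n)             ≈⟨ -‿cong (fromℕ-+ (suc m) (suc n)) ⟩
      - (fromℕ (suc m) + fromℕ (suc n))     ≈⟨ AG.⁻¹-∙-comm _ _ ⟨
      - fromℕ (suc m) - fromℕ (suc n)       ∎

    fromℤ-neg : ∀ i → fromℤ (ℤ.- i) ≈ - fromℤ i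
    fromℤ-neg (+ zero)  = sym RP.-0#≈0#
    fromℤ-neg (+ suc n) = refl
    fromℤ-neg -[1+ n ]  = sym (RP.-‿involutive _)

    fromℤ-◃ : ∀ s n → fromℤ (s ℤ.◃ n) ≈ signed s (fromℕ n)
    fromℤ-◃ Sign.+ zero    = refl
    fromℤ-◃ Sign.- zero    = sym RP.-0#≈0#
    fromℤ-◃ Sign.+ (suc n) = refl
    fromℤ-◃ Sign.- (suc n) = refl

    fromℤ-sign-abs : ∀ i → fromℤ i ≡ signed (ℤ.sign i) (fromℕ ℤ.∣ i ∣)
    fromℤ-sign-abs (+ n)    = ≡.refl
    fromℤ-sign-abs -[1+ n ] = ≡.refl

    signed-* : ∀ s t x y → signed (s Sign.* t) (x * y) ≈ signed s x * signed t y
    signed-* Sign.+ Sign.+ x y = refl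
    signed-* Sign.+ Sign.- x y = RP.-‿distribʳ-* x y
    signed-* Sign.- Sign.+ x y = RP.-‿distribˡ-* x y
    signed-* Sign.- Sign.- x y = sym (begin
      - x * - y     ≈⟨ RP.-‿distribˡ-* x (- y) ⟨
      - (x * - y)   ≈⟨ -‿cong (RP.-‿distribʳ-* x y) ⟨
      - - (x * y)   ≈⟨ RP.-‿involutive _ ⟩
      x * y         ∎)

    signed-cong : ∀ s {x y} → x ≈ y → signed s x ≈ signed s y
    signed-cong Sign.+ p = p
    signed-cong Sign.- p = -‿cong p

    fromℤ-* : ∀ i j → fromℤ (i ℤ.* j) ≈ fromℤ i * fromℤ j
    fromℤ-* i j = begin
      fromℤ (i ℤ.* j)
        ≈⟨ fromℤ-◃ s (ℤ.∣ i ∣ ℕ.* ℤ.∣ j ∣) ⟩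
      signed s (fromℕ (ℤ.∣ i ∣ ℕ.* ℤ.∣ j ∣))
        ≈⟨ signed-cong s (fromℕ-* ℤ.∣ i ∣ ℤ.∣ j ∣) ⟩
      signed s (fromℕ ℤ.∣ i ∣ * fromℕ ℤ.∣ j ∣)
        ≈⟨ signed-* (ℤ.sign i) (ℤ.sign j) _ _ ⟩
      signed (ℤ.sign i) (fromℕ ℤ.∣ i ∣) * signed (ℤ.sign j) (fromℕ ℤ.∣ j ∣)
        ≡⟨ ≡.cong₂ _*_ (fromℤ-sign-abs i) (fromℤ-sign-abs j) ⟨
      fromℤ i * fromℤ j ∎
      where s = ℤ.sign i Sign.* ℤ.sign j

    morphism : ℤ.+-*-rawRing -Raw-AlmostCommutative⟶ fromCommutativeRing commutativeRing
    morphism = record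
      { ⟦_⟧    = fromℤ
      ; +-homo = fromℤ-+
      ; *-homo = fromℤ-*
      ; -‿homo = fromℤ-neg
      ; 0-homo = refl
      ; 1-homo = +-identityʳ 1#
      }

    _coeff≟_ : ∀ i j → Maybe (fromℤ i ≈ fromℤ j)
    i coeff≟ j = Maybe.map (λ p → reflexive (≡.cong fromℤ p)) (dec⇒maybe (i ℤ.≟ j))

  -- The integers as coefficients: equality of coefficients has to be
  -- decidable for terms to cancel, and that of ℝ is not.
  open RingSolver ℤ.+-*-rawRing (fromCommutativeRing commutativeRing) morphism _coeff≟_ public
    using (solve; _:=_; _:+_; _:*_; _:-_; :-_; con; Polynomial)

  :0 : ∀ {k} → Polynomial k
  :0 = con (+ 0)

  :1 : ∀ {k} → Polynomial k
  :1 = con (+ 1)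

  :2 : ∀ {k} → Polynomial k
  :2 = con (+ 2)

  :4 : ∀ {k} → Polynomial k
  :4 = con (+ 4)

  -- The constructive order.

  <⇒≤ : ∀ {x y} → x < y → x ≤ y
  <⇒≤ x<y y<x = <-irrefl refl (<-trans x<y y<x)

  ≤-reflexive : ∀ {x y} → x ≈ y → x ≤ y
  ≤-reflexive x≈y y<x = <-irrefl (sym x≈y) y<x

  ≤-refl : ∀ {x} → x ≤ x
  ≤-refl = ≤-reflexive refl

  -- Inherited from cotransitivity of apartness: if `y` is apart from `x` or `z` on the outer side,
  -- transitivity puts it on the right side of the other one. It replaces trichotomy.
  <-cotrans : ∀ {x z} → x < z → ∀ y → x < y ⊎ y < z
  <-cotrans x<z y with #-cotrans (Equivalence.from #⇔<⊎> (inj₁ x<z)) y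
  ... | inj₁ x#y with Equivalence.to #⇔<⊎> x#y
  ...   | inj₁ x<y = inj₁ x<y
  ...   | inj₂ y<x = inj₂ (<-trans y<x x<z)
  <-cotrans x<z y | inj₂ y#z with Equivalence.to #⇔<⊎> y#z
  ...   | inj₁ y<z = inj₂ y<z
  ...   | inj₂ z<y = inj₁ (<-trans x<z z<y)

  ≤-trans : ∀ {x y z} → x ≤ y → y ≤ z → x ≤ z
  ≤-trans {y = y} x≤y y≤z z<x with <-cotrans z<x y
  ... | inj₁ z<y = y≤z z<y
  ... | inj₂ y<x = x≤y y<x

  ≤-antisym : ∀ {x y} → x ≤ y → y ≤ x → x ≈ y
  ≤-antisym {x} {y} x≤y y≤x = proj₁ (tight x y) ¬x#y
    where
    ¬x#y : ¬ (x # y)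
    ¬x#y x#y with Equivalence.to #⇔<⊎> x#y
    ... | inj₁ x<y = y≤x x<y
    ... | inj₂ y<x = x≤y y<x

  ≤-poset : Poset c ℓ₁ ℓ₂
  ≤-poset = record
    { isPartialOrder = record
      { isPreorder = record
        { isEquivalence = isEquivalence
        ; reflexive     = ≤-reflexive
        ; trans         = ≤-trans
        }
      ; antisym = ≤-antisym
      }
    }

  -- Licenses a case distinction on the order whenever the goal is a negation, as every goal `x ≤ y`
  -- is.
  ¬¬-≤-total : ∀ x y → ¬ ¬ (x ≤ y ⊎ y ≤ x)
  ¬¬-≤-total x y k = k (inj₁ λ y<x → k (inj₂ (<⇒≤ y<x)))

  -- The refutation of `0# < x` is literally `x ≤ 0#`, so antisymmetry applies.
  nonneg⇒¬¬pos : ∀ {x} → 0# ≤ x → ¬ (x ≈ 0#) → ¬ ¬ (0# < x)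
  nonneg⇒¬¬pos 0≤x x≉0 x≤0 = x≉0 (≤-antisym x≤0 0≤x)

  y-x≥0⇒x≤y : ∀ {x y} → 0# ≤ y - x → x ≤ y
  y-x≥0⇒x≤y {x} 0≤y-x y<x = 0≤y-x (<-respʳ-≈ (-‿inverseʳ x) (+-monoˡ-< (- x) y<x))

  x≤y⇒y-x≥0 : ∀ {x y} → x ≤ y → 0# ≤ y - x
  x≤y⇒y-x≥0 {x} {y} x≤y y-x<0 = x≤y
    (<-respˡ-≈ (solve 2 (λ x y → y :- x :+ x := y) refl x y)
      (<-respʳ-≈ (+-identityˡ x) (+-monoˡ-< x y-x<0)))

  -- The usual shape of an inequality proof below: `t` is visibly nonnegative and the equation is
  -- left to the ring solver.
  ≤-by : ∀ {x y t} → 0# ≤ t → y - x ≈ t → x ≤ y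
  ≤-by 0≤t y-x≈t = y-x≥0⇒x≤y (≤-trans 0≤t (≤-reflexive (sym y-x≈t)))

  +-mono-≤ : ∀ {x y u v} → x ≤ y → u ≤ v → x + u ≤ y + v
  +-mono-≤ {x} {y} {u} {v} x≤y u≤v = ≤-trans
    (≤-by (x≤y⇒y-x≥0 x≤y) (solve 3 (λ x y u → (y :+ u) :- (x :+ u) := y :- x) refl x y u))
    (≤-by (x≤y⇒y-x≥0 u≤v) (solve 3 (λ y u v → (y :+ v) :- (y :+ u) := v :- u) refl y u v))

  +-nonneg : ∀ {x y} → 0# ≤ x → 0# ≤ y → 0# ≤ x + y
  +-nonneg 0≤x 0≤y = ≤-trans (≤-reflexive (sym (+-identityʳ 0#))) (+-mono-≤ 0≤x 0≤y)

  -- A zero factor would make the product zero, so, the goal being a negation, both factors may be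
  -- taken strictly positive.
  *-nonneg : ∀ {x y} → 0# ≤ x → 0# ≤ y → 0# ≤ x * y
  *-nonneg {x} {y} 0≤x 0≤y xy<0 =
    nonneg⇒¬¬pos 0≤x x≉0 λ 0<x → nonneg⇒¬¬pos 0≤y y≉0 λ 0<y →
    <-irrefl refl (<-trans (*-pos 0<x 0<y) xy<0)
    where
    x≉0 : ¬ (x ≈ 0#)
    x≉0 x≈0 = <-irrefl (trans (*-congʳ x≈0) (zeroˡ y)) xy<0

    y≉0 : ¬ (y ≈ 0#)
    y≉0 y≈0 = <-irrefl (trans (*-congˡ y≈0) (zeroʳ x)) xy<0

  *-monoʳ-≤ : ∀ {x y z} → 0# ≤ z → x ≤ y → z * x ≤ z * y
  *-monoʳ-≤ {x} {y} {z} 0≤z x≤y = ≤-by (*-nonneg 0≤z (x≤y⇒y-x≥0 x≤y))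
    (solve 3 (λ x y z → z :* y :- z :* x := z :* (y :- x)) refl x y z)

  *-monoˡ-≤ : ∀ {x y z} → 0# ≤ z → x ≤ y → x * z ≤ y * z
  *-monoˡ-≤ {x} {y} {z} 0≤z x≤y = ≤-by (*-nonneg 0≤z (x≤y⇒y-x≥0 x≤y))
    (solve 3 (λ x y z → y :* z :- x :* z := z :* (y :- x)) refl x y z)

  *-cancelʳ-≤ : ∀ {x y z} → 0# < z → x * z ≤ y * z → x ≤ y
  *-cancelʳ-≤ 0<z xz≤yz y<x = xz≤yz (*-monoˡ-<-pos 0<z y<x)

  *-cancelˡ-≤ : ∀ {x y z} → 0# < z → z * x ≤ z * y → x ≤ y
  *-cancelˡ-≤ {x} {y} {z} 0<z zx≤zy = *-cancelʳ-≤ 0<z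
    (≤-trans (≤-reflexive (*-comm x z)) (≤-trans zx≤zy (≤-reflexive (*-comm z y))))

  -‿mono-≤ : ∀ {x y} → x ≤ y → - y ≤ - x
  -‿mono-≤ {x} {y} x≤y = ≤-by (x≤y⇒y-x≥0 x≤y)
    (solve 2 (λ x y → (:- x) :- (:- y) := y :- x) refl x y)

  ²-nonneg : ∀ x → 0# ≤ x ²
  ²-nonneg x x²<0 = ¬¬-≤-total 0# x λ where
    (inj₁ 0≤x) → *-nonneg 0≤x 0≤x x²<0
    (inj₂ x≤0) → *-nonneg (≤-trans (≤-reflexive (sym RP.-0#≈0#)) (-‿mono-≤ x≤0))
                          (≤-trans (≤-reflexive (sym RP.-0#≈0#)) (-‿mono-≤ x≤0))
                          (<-respˡ-≈ (sym (solve 1 (λ x → (:- x) :* (:- x) := x :* x) refl x)) x²<0)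

  -- By tightness it is enough that `x` is not apart from zero; if it were, its square would be
  -- positive.
  x²≈0⇒x≈0 : ∀ {x} → x ² ≈ 0# → x ≈ 0#
  x²≈0⇒x≈0 {x} x²≈0 = proj₁ (tight x 0#) λ x#0 → contra (Equivalence.to #⇔<⊎> x#0)
    where
    contra : ¬ (x < 0# ⊎ 0# < x)
    contra (inj₂ 0<x) = <-irrefl (sym x²≈0) (*-pos 0<x 0<x)
    contra (inj₁ x<0) = <-irrefl (sym x²≈0)
      (<-respʳ-≈ (solve 1 (λ x → (:0 :- x) :* (:0 :- x) := x :* x) refl x)
        (*-pos (x<y⇒0<y-x x<0) (x<y⇒0<y-x x<0)))

  fromℕ-nonneg : ∀ n → 0# ≤ fromℕ n
  fromℕ-nonneg zero    = ≤-refl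
  fromℕ-nonneg (suc n) = <⇒≤ (fromℕ-pos n)

  fromℕ-mono : ∀ {m n} → m ℕ.≤ n → fromℕ m ≤ fromℕ n
  fromℕ-mono {n = n} z≤n = fromℕ-nonneg n
  fromℕ-mono (s≤s m≤n)   = +-mono-≤ ≤-refl (fromℕ-mono m≤n)

  1/ℕ-nonneg : ∀ n → 0# ≤ 1/ℕ n
  1/ℕ-nonneg zero    = ≤-refl
  1/ℕ-nonneg (suc n) = <⇒≤ (recip-pos _ (fromℕ-pos n))

  1/∞-nonneg : ∀ N → 0# ≤ 1/∞ N
  1/∞-nonneg (fin N 0<N) = <⇒≤ (recip-pos N 0<N)
  1/∞-nonneg ∞           = ≤-refl

  double-half : ∀ x → fromℕ 2 * (½ * x) ≈ x
  double-half x = trans (sym (*-assoc _ _ _))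
    (trans (*-congʳ (recip-inverse (fromℕ 2) (fromℕ-pos 1))) (*-identityˡ x))

-- Finite choice under a double negation; it allows walks to be chosen for all vertices at once.
¬¬-Fin-∀ : ∀ {n p} {P : Fin n → Set p} → (∀ i → ¬ ¬ P i) → ¬ ¬ (∀ i → P i)
¬¬-Fin-∀ {zero}  ¬¬P k = k λ ()
¬¬-Fin-∀ {suc n} ¬¬P k = ¬¬P Fin.zero λ p₀ → ¬¬-Fin-∀ (λ i → ¬¬P (Fin.suc i)) λ ps →
  k λ { Fin.zero → p₀ ; (Fin.suc i) → ps i }

-- Shortest and non-backtracking walks.

module Walks {n} (G : SignedGraph n) where
  open SignedGraph G
  open DecMembership (Fin._≟_ {n}) using (_∈?_)

  -- Strong induction on the length: if no walk were shortest, there would be none of any length.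
  shortest : ∀ {x y k} → Walk x y k → ¬ ¬ ∃ (IsDistance x y)
  shortest {x} {y} {k} w none = <-rec (λ k → ¬ Walk x y k)
    (λ k ih w → none (k , w , λ m v → ℕ.≮⇒≥ λ m<k → ih m<k v)) k w

  -- The diameter bounds distances only, so each connecting walk is first replaced by a shortest
  -- one.
  walks-within-diameter : ∀ {D} → Connected → IsDiameter D → ∀ y →
    ¬ ¬ (∀ x → ∃[ k ] k ℕ.≤ D × Walk x y k)
  walks-within-diameter connected (_ , bound) y = ¬¬-Fin-∀ λ x none →
    shortest (proj₂ (connected x y)) λ (k , w , min) → none (k , bound x y k (w , min) , w)

  -- Makes the two edges at an inner vertex lead to distinct neighbours, so that both count in the
  -- energy density there.
  NonBacktracking : ∀ {x y k} → Walk x y k → Set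
  NonBacktracking []                                = ⊤
  NonBacktracking (_ ∷ [])                          = ⊤
  NonBacktracking (_∷_ {x = x} _ (_∷_ {y = z} e w)) = x ≢ z × NonBacktracking (e ∷ w)

  tail-nonBacktracking : ∀ {x y z k} (e : x ∼ y) (w : Walk y z k) →
    NonBacktracking (e ∷ w) → NonBacktracking w
  tail-nonBacktracking e []      _        = tt
  tail-nonBacktracking e (_ ∷ _) (_ , nb) = nb

  -- A step from `x` to `y` and straight back contributes `σ x y * σ y x = +`, so deleting it keeps
  -- the sign.
  reduce : ∀ {x y k} (w : Walk x y k) →
    ∃[ l ] ∃[ v ] l ℕ.≤ k × walkSign {x} {y} {l} v ≡ walkSign w × NonBacktracking v
  reduce [] = 0 , [] , z≤n , ≡.refl , tt
  reduce (_∷_ {x = x} e w) with reduce w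
  ... | _ , []       , l≤k , s≡ , nb = 1 , e ∷ [] , s≤s z≤n , ≡.cong (σ x _ Sign.*_) s≡ , tt
  ... | _ , _∷_ {x = y} {y = z} {k = l} e′ v , l≤k , s≡ , nb with x Fin.≟ z
  ...   | no x≢z     = _ , e ∷ e′ ∷ v , s≤s l≤k , ≡.cong (σ x y Sign.*_) s≡ , x≢z , nb
  ...   | yes ≡.refl = l , v , ℕ.≤-trans (ℕ.n≤1+n l) (ℕ.m≤n⇒m≤1+n l≤k) , sign≡
                   , tail-nonBacktracking e′ v nb
    where
    sign≡ : walkSign v ≡ σ x y Sign.* walkSign w
    sign≡ = begin
      walkSign v                                ≡⟨ ≡.cong (Sign._* walkSign v) (Sign.s*s≡+ (σ x y)) ⟨
      σ x y Sign.* σ x y Sign.* walkSign v      ≡⟨ Sign.*-assoc (σ x y) (σ x y) (walkSign v) ⟩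
      σ x y Sign.* (σ x y Sign.* walkSign v)    ≡⟨ ≡.cong (λ s → σ x y Sign.* (s Sign.* walkSign v)) (σ-sym e) ⟩
      σ x y Sign.* (σ y x Sign.* walkSign v)    ≡⟨ ≡.cong (σ x y Sign.*_) s≡ ⟩
      σ x y Sign.* walkSign w                   ∎
      where open ≡.≡-Reasoning

  -- Concatenation, closed walks and balance.

  infixr 5 _++_

  _++_ : ∀ {x y z k l} → Walk x y k → Walk y z l → Walk x z (k ℕ.+ l)
  []      ++ v = v
  (e ∷ w) ++ v = e ∷ (w ++ v)

  walkSign-++ : ∀ {x y z k l} (w : Walk x y k) (v : Walk y z l) →
    walkSign (w ++ v) ≡ walkSign w Sign.* walkSign v
  walkSign-++ []                        v = ≡.refl
  walkSign-++ (_∷_ {x = x} {y = y} e w) v =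
    ≡.trans (≡.cong (σ x y Sign.*_) (walkSign-++ w v)) (≡.sym (Sign.*-assoc (σ x y) _ _))

  reverse : ∀ {x y k} (w : Walk x y k) → ∃[ l ] ∃[ v ] walkSign {y} {x} {l} v ≡ walkSign w
  reverse []                        = 0 , [] , ≡.refl
  reverse (_∷_ {x = x} {y = y} e w) with reverse w
  ... | _ , v , s≡ = _ , v ++ (∼-sym e ∷ []) , (begin
    walkSign (v ++ (∼-sym e ∷ []))            ≡⟨ walkSign-++ v (∼-sym e ∷ []) ⟩
    walkSign v Sign.* (σ y x Sign.* Sign.+)   ≡⟨ ≡.cong₂ Sign._*_ s≡ (Sign.*-identityʳ (σ y x)) ⟩
    walkSign w Sign.* σ y x                   ≡⟨ Sign.*-comm (walkSign w) (σ y x) ⟩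
    σ y x Sign.* walkSign w                   ≡⟨ ≡.cong (Sign._* walkSign w) (σ-sym e) ⟨
    σ x y Sign.* walkSign w                   ∎)
    where open ≡.≡-Reasoning

  -- `starts` omits the final vertex, so at least one edge follows the occurrence of `z`; hence
  -- `suc b`.
  split : ∀ {x y z k} (w : Walk x y k) → z ∈ starts w →
    ∃[ a ] ∃[ b ] ∃[ u ] ∃[ v ]
      (a ℕ.+ suc b ≡ k × walkSign {x} {z} {a} u Sign.* walkSign {z} {y} {suc b} v ≡ walkSign w)
  split (e ∷ w) (here ≡.refl) = 0 , _ , [] , e ∷ w , ≡.refl , ≡.refl
  split (_∷_ {x = x} {y = y} e w) (there z∈w) with split w z∈w
  ... | a , b , u , v , l≡ , s≡ =
    suc a , b , e ∷ u , v , ≡.cong suc l≡ , ≡.trans (Sign.*-assoc (σ x y) _ _) (≡.cong (σ x y Sign.*_) s≡)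

  -- Both `v` and `t` have positive length, so `v` and `u ++ t` are strictly shorter than `w`; this
  -- drives the induction in `closed-walk-positive`.
  data Detour {x y k} (w : Walk x y k) : Set where
    detour : ∀ {z a b c} (u : Walk x z a) (v : Walk z z (suc b)) (t : Walk z y (suc c)) →
      a ℕ.+ (suc b ℕ.+ suc c) ≡ k → walkSign u Sign.* (walkSign v Sign.* walkSign t) ≡ walkSign w →
      Detour w

  unique-or-detour : ∀ {x y k} (w : Walk x y k) → Unique (starts w) ⊎ Detour w
  unique-or-detour [] = inj₁ []
  unique-or-detour (_∷_ {x = x} {y = y} e w) with unique-or-detour w
  ... | inj₂ (detour u v t l≡ s≡) = inj₂ (detour (e ∷ u) v t (≡.cong suc l≡)
          (≡.trans (Sign.*-assoc (σ x y) _ _) (≡.cong (σ x y Sign.*_) s≡)))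
  ... | inj₁ unique with x ∈? starts w
  ...   | no x∉w  = inj₁ (¬Any⇒All¬ _ x∉w ∷ unique)
  ...   | yes x∈w with split w x∈w
  ...     | a , b , u , v , l≡ , s≡ = inj₂ (detour [] (e ∷ u) v (≡.cong suc l≡)
              (≡.trans (Sign.*-assoc (σ x y) _ _) (≡.cong (σ x y Sign.*_) s≡)))

  -- Strong induction on the length: a repeated vertex cuts the walk into two shorter closed walks
  -- whose signs multiply to its own; without one, the walk is a cycle or has length at most two.
  closed-walk-positive : Balanced → ∀ {k x} (w : Walk x x k) → walkSign w ≡ Sign.+
  closed-walk-positive balanced {k} = <-rec (λ k → ∀ {x} (w : Walk x x k) → walkSign w ≡ Sign.+) step k
    where
    step : ∀ k → (∀ {m} → m ℕ.< k → ∀ {x} (w : Walk x x m) → walkSign w ≡ Sign.+) →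
           ∀ {x} (w : Walk x x k) → walkSign w ≡ Sign.+
    step k ih w with unique-or-detour w
    step k ih w | inj₂ (detour {a = a} {b} {c} u v t ≡.refl s≡) = begin
      walkSign w                                          ≡⟨ s≡ ⟨
      walkSign u Sign.* (walkSign v Sign.* walkSign t)    ≡⟨ ≡.cong (λ s → walkSign u Sign.* (s Sign.* walkSign t)) (ih b<k v) ⟩
      walkSign u Sign.* walkSign t                        ≡⟨ walkSign-++ u t ⟨
      walkSign (u ++ t)                                   ≡⟨ ih ac<k (u ++ t) ⟩
      Sign.+                                              ∎
      where
      open ≡.≡-Reasoning
      b<k : suc b ℕ.< a ℕ.+ (suc b ℕ.+ suc c)
      b<k = ℕ.<-≤-trans (ℕ.m<m+n (suc b) (s≤s z≤n)) (ℕ.m≤n+m _ a)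
      ac<k : a ℕ.+ suc c ℕ.< a ℕ.+ (suc b ℕ.+ suc c)
      ac<k = ℕ.+-monoʳ-< a (ℕ.m<n+m (suc c) (s≤s z≤n))
    -- Lengths below three are not cycles: length one would be a loop, and length two runs through
    -- one edge back and forth.
    step _ ih []                                    | inj₁ _ = ≡.refl
    step _ ih (e ∷ [])                              | inj₁ _ = ⊥-elim (∼-irrefl ≡.refl e)
    step _ ih (_∷_ {x = x} {y = y} e (e′ ∷ []))     | inj₁ _ = begin
      σ x y Sign.* (σ y x Sign.* Sign.+)   ≡⟨ ≡.cong (σ x y Sign.*_) (Sign.*-identityʳ (σ y x)) ⟩
      σ x y Sign.* σ y x                   ≡⟨ ≡.cong (σ x y Sign.*_) (σ-sym e) ⟨
      σ x y Sign.* σ x y                   ≡⟨ Sign.s*s≡+ (σ x y) ⟩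
      Sign.+                               ∎
      where open ≡.≡-Reasoning
    step _ ih w@(_ ∷ _ ∷ _ ∷ _) | inj₁ unique = balanced w (s≤s (s≤s (s≤s z≤n)) , unique)

  -- Following `w` by the reverse of `v` gives a closed walk, whose sign is the product of the two
  -- signs.
  walkSign-unique : Balanced → ∀ {x y k l} (w : Walk x y k) (v : Walk x y l) →
    walkSign w ≡ walkSign v
  walkSign-unique balanced w v with reverse v
  ... | _ , v⁻¹ , s≡ = begin
    walkSign w                                      ≡⟨ Sign.*-identityʳ _ ⟨
    walkSign w Sign.* Sign.+                        ≡⟨ ≡.cong (walkSign w Sign.*_) (Sign.s*s≡+ (walkSign v)) ⟨
    walkSign w Sign.* (walkSign v Sign.* walkSign v)  ≡⟨ Sign.*-assoc (walkSign w) _ _ ⟨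
    walkSign w Sign.* walkSign v Sign.* walkSign v  ≡⟨ ≡.cong (λ s → walkSign w Sign.* s Sign.* walkSign v) s≡ ⟨
    walkSign w Sign.* walkSign v⁻¹ Sign.* walkSign v ≡⟨ ≡.cong (Sign._* walkSign v) (walkSign-++ w v⁻¹) ⟨
    walkSign (w ++ v⁻¹) Sign.* walkSign v           ≡⟨ ≡.cong (Sign._* walkSign v) (closed-walk-positive balanced (w ++ v⁻¹)) ⟩
    walkSign v                                      ∎
    where open ≡.≡-Reasoning

-- Maxima and sums over finite sets.

module Estimates {c ℓ₁ ℓ₂} (R : RealNumbers c ℓ₁ ℓ₂) {n} (G : SignedGraph n) where
  open RealNumbers R
  open OrderedField R
  open SignedGraph G
  open Walks G
  open SignedLaplacian R G
  open PosetReasoning ≤-poset hiding (step-<)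

  -- The first value is compared with the maximum of the others under a double negation. The
  -- argument in `Fin m` excludes the empty set.
  ¬¬-maximum : ∀ {m} → Fin m → (h : Fin m → ℝ) → ¬ ¬ (∃[ v ] ∀ x → h x ≤ h v)
  ¬¬-maximum {suc zero}    _ h k = k (Fin.zero , λ { Fin.zero → ≤-refl })
  ¬¬-maximum {suc (suc m)} _ h k =
    ¬¬-maximum Fin.zero (λ i → h (Fin.suc i)) λ (v , max) →
    ¬¬-≤-total (h Fin.zero) (h (Fin.suc v)) λ where
      (inj₁ ≤v) → k (Fin.suc v , λ { Fin.zero → ≤v ; (Fin.suc i) → max i })
      (inj₂ v≤) → k (Fin.zero , λ { Fin.zero → ≤-refl ; (Fin.suc i) → ≤-trans (max i) v≤ })

  module _ {a} {A : Set a} where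
    ∑-cong : ∀ (xs : List A) {f g : A → ℝ} → (∀ {y} → y ∈ xs → f y ≈ g y) →
             ∑ (map f xs) ≈ ∑ (map g xs)
    ∑-cong []       f≈g = refl
    ∑-cong (x ∷ xs) f≈g = +-cong (f≈g (here ≡.refl)) (∑-cong xs λ y∈ → f≈g (there y∈))

    ∑-nonneg : ∀ (xs : List A) {f : A → ℝ} → (∀ y → 0# ≤ f y) → 0# ≤ ∑ (map f xs)
    ∑-nonneg []       0≤f = ≤-refl
    ∑-nonneg (x ∷ xs) 0≤f = +-nonneg (0≤f x) (∑-nonneg xs 0≤f)

    ∑-linear : ∀ (xs : List A) r t (f g : A → ℝ) →
               ∑ (map (λ y → r * f y + t * g y) xs) ≈ r * ∑ (map f xs) + t * ∑ (map g xs)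
    ∑-linear [] r t f g = solve 2 (λ r t → :0 := r :* :0 :+ t :* :0) refl r t
    ∑-linear (x ∷ xs) r t f g = trans (+-congˡ (∑-linear xs r t f g))
      (solve 6 (λ r t a b u v → r :* a :+ t :* b :+ (r :* u :+ t :* v)
                             := r :* (a :+ u) :+ t :* (b :+ v))
        refl r t (f x) (g x) (∑ (map f xs)) (∑ (map g xs)))

    ∑-scale : ∀ (xs : List A) r (f : A → ℝ) → ∑ (map (λ y → r * f y) xs) ≈ r * ∑ (map f xs)
    ∑-scale []       r f = sym (zeroʳ r)
    ∑-scale (x ∷ xs) r f = trans (+-congˡ (∑-scale xs r f)) (sym (distribˡ r _ _))

    ∑-term : ∀ {xs : List A} {f : A → ℝ} → (∀ y → 0# ≤ f y) → ∀ {y} → y ∈ xs →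
             f y ≤ ∑ (map f xs)
    ∑-term {_ ∷ xs} 0≤f (here ≡.refl) =
      ≤-trans (≤-reflexive (sym (+-identityʳ _))) (+-mono-≤ ≤-refl (∑-nonneg xs 0≤f))
    ∑-term {x ∷ xs} 0≤f (there y∈)    =
      ≤-trans (≤-reflexive (sym (+-identityˡ _))) (+-mono-≤ (0≤f x) (∑-term 0≤f y∈))

    -- Distinct elements occupy different positions of the list, so their terms are separate
    -- summands.
    ∑-two-terms : ∀ {xs : List A} {f : A → ℝ} → (∀ y → 0# ≤ f y) → ∀ {y z} → y ≢ z →
                  y ∈ xs → z ∈ xs → f y + f z ≤ ∑ (map f xs)
    ∑-two-terms 0≤f y≢z (here ≡.refl) (here ≡.refl) = ⊥-elim (y≢z ≡.refl)
    ∑-two-terms 0≤f y≢z (here ≡.refl) (there z∈)    = +-mono-≤ ≤-refl (∑-term 0≤f z∈)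
    ∑-two-terms 0≤f y≢z (there y∈)    (here ≡.refl) =
      ≤-trans (≤-reflexive (+-comm _ _)) (+-mono-≤ ≤-refl (∑-term 0≤f y∈))
    ∑-two-terms {x ∷ xs} 0≤f y≢z (there y∈) (there z∈) =
      ≤-trans (≤-reflexive (sym (+-identityˡ _))) (+-mono-≤ (0≤f x) (∑-two-terms 0≤f y≢z y∈ z∈))

    -- For the empty list both sides are zero, so the default value of `1/ℕ zero` does no harm at
    -- isolated vertices.
    length*average : ∀ (xs : List A) (f : A → ℝ) →
      fromℕ (length xs) * (1/ℕ (length xs) * ∑ (map f xs)) ≈ ∑ (map f xs)
    length*average []          f = zeroˡ _
    length*average xs@(_ ∷ ys) f = trans (sym (*-assoc _ _ _))
      (trans (*-congʳ (recip-inverse _ (fromℕ-pos (length ys)))) (*-identityˡ _))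

  -- Linearity of the Laplacian and the maximum principle.

  ·-cong : ∀ s {a b} → a ≈ b → s · a ≈ s · b
  ·-cong Sign.+ a≈b = a≈b
  ·-cong Sign.- a≈b = -‿cong a≈b

  ·-linear : ∀ s r t a b → s · (r * a + t * b) ≈ r * (s · a) + t * (s · b)
  ·-linear Sign.+ r t a b = refl
  ·-linear Sign.- r t a b =
    solve 4 (λ r t a b → :- (r :* a :+ t :* b) := r :* (:- a) :+ t :* (:- b)) refl r t a b

  laplacian-cong : ∀ τ {f g : Function} → (∀ y → f y ≈ g y) → ∀ x → laplacian τ f x ≈ laplacian τ g x
  laplacian-cong τ f≈g x = *-congˡ (∑-cong (neighbours x) λ {y} _ →
    +-cong (·-cong (τ x y) (f≈g y)) (-‿cong (f≈g x)))

  laplacian-linear : ∀ τ r t (f g : Function) x →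
    laplacian τ (λ y → r * f y + t * g y) x ≈ r * laplacian τ f x + t * laplacian τ g x
  laplacian-linear τ r t f g x = trans (*-congˡ
      (trans (∑-cong (neighbours x) λ {y} _ → pointwise (τ x y) (f y) (g y)) (∑-linear (neighbours x) r t _ _)))
    (solve 5 (λ c r t a b → c :* (r :* a :+ t :* b) := r :* (c :* a) :+ t :* (c :* b)) refl _ r t _ _)
    where
    pointwise : ∀ s a b → (s · (r * a + t * b)) - (r * f x + t * g x)
                          ≈ r * ((s · a) - f x) + t * ((s · b) - g x)
    pointwise s a b = trans (+-congʳ (·-linear s r t a b))
      (solve 6 (λ r t a b u v → r :* a :+ t :* b :- (r :* u :+ t :* v)
                             := r :* (a :- u) :+ t :* (b :- v)) refl r t _ _ (f x) (g x))

  laplacian-scale : ∀ τ r (f : Function) x → laplacian τ (λ y → r * f y) x ≈ r * laplacian τ f x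
  laplacian-scale τ r f x = begin-equality
    laplacian τ (λ y → r * f y) x
      ≈⟨ laplacian-cong τ (λ y → solve 2 (λ r a → r :* a := r :* a :+ :0 :* a) refl r (f y)) x ⟩
    laplacian τ (λ y → r * f y + 0# * f y) x
      ≈⟨ laplacian-linear τ r 0# f f x ⟩
    r * laplacian τ f x + 0# * laplacian τ f x
      ≈⟨ solve 2 (λ r a → r :* a :+ :0 :* a := r :* a) refl r _ ⟩
    r * laplacian τ f x ∎

  unsigned : Fin n → Fin n → Sign
  unsigned _ _ = Sign.+

  minimum-principle : ∀ (h : Function) v → (∀ y → h v ≤ h y) → 0# ≤ Δ h v
  minimum-principle h v min = *-nonneg (1/ℕ-nonneg (deg v))
    (∑-nonneg (neighbours v) λ y → x≤y⇒y-x≥0 (min y))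

  maximum-principle : ∀ (h : Function) v → (∀ y → h y ≤ h v) → Δ h v ≤ 0#
  maximum-principle h v max = ≤-by
    (minimum-principle (λ y → - fromℕ 1 * h y) v λ y → ≤-by (x≤y⇒y-x≥0 (max y))
      (solve 2 (λ a b → (:- :1) :* a :- (:- :1) :* b := b :- a) refl (h y) (h v)))
    (trans (solve 1 (λ a → :0 :- a := (:- :1) :* a) refl _)
           (sym (laplacian-scale unsigned (- fromℕ 1) h v)))

  -- The gradient form as an energy.

  difference : Function → Fin n → Fin n → ℝ
  difference f x y = f x - (σ x y · f y)

  energyDensity : Function → Function
  energyDensity f x = ∑ (map (λ y → difference f x y ²) (neighbours x))

  2Γσ : ∀ f g x → fromℕ 2 * Γσ f g x ≈ Δ (λ y → f y * g y) x - g x * Δσ f x - f x * Δσ g x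
  2Γσ f g x = double-half _

  -- Termwise, with `s = σ x y`, `u = f x` and `a = f y`: `a² - u² - 2u(s a - u) = (u - s a)²`,
  -- because `s² = 1`.
  2Γσ≈energy : ∀ f x → fromℕ 2 * Γσ f f x ≈ 1/ℕ (deg x) * energyDensity f x
  2Γσ≈energy f x = begin-equality
    fromℕ 2 * Γσ f f x
      ≈⟨ 2Γσ f f x ⟩
    Δ (λ y → f y * f y) x - f x * Δσ f x - f x * Δσ f x
      ≈⟨ solve 4 (λ r u a b → r :* a :- u :* (r :* b) :- u :* (r :* b)
                           := r :* (:1 :* a :+ :- (:2 :* u) :* b)) refl (1/ℕ (deg x)) (f x) _ _ ⟩
    1/ℕ (deg x) * (fromℕ 1 * ∑ (map (λ y → f y * f y - f x * f x) (neighbours x))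
      + - (fromℕ 2 * f x) * ∑ (map (λ y → (σ x y · f y) - f x) (neighbours x)))
      ≈⟨ *-congˡ (∑-linear (neighbours x) _ _ _ _) ⟨
    1/ℕ (deg x) * ∑ (map (λ y → fromℕ 1 * (f y * f y - f x * f x)
      + - (fromℕ 2 * f x) * ((σ x y · f y) - f x)) (neighbours x))
      ≈⟨ *-congˡ (∑-cong (neighbours x) λ {y} _ → pointwise (σ x y) (f x) (f y)) ⟩
    1/ℕ (deg x) * energyDensity f x ∎
    where
    pointwise : ∀ s u a → fromℕ 1 * (a * a - u * u) + - (fromℕ 2 * u) * ((s · a) - u) ≈ (u - (s · a)) ²
    pointwise Sign.+ = solve 2 (λ u a → :1 :* (a :* a :- u :* u) :+ :- (:2 :* u) :* (a :- u)
                                     := (u :- a) :* (u :- a)) refl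
    pointwise Sign.- = solve 2 (λ u a → :1 :* (a :* a :- u :* u) :+ :- (:2 :* u) :* (:- a :- u)
                                     := (u :- :- a) :* (u :- :- a)) refl

  energyDensity≈deg*2Γσ : ∀ f x → energyDensity f x ≈ fromℕ (deg x) * (fromℕ 2 * Γσ f f x)
  energyDensity≈deg*2Γσ f x = sym (trans (*-congˡ (2Γσ≈energy f x)) (length*average (neighbours x) _))

  2Γσ-nonneg : ∀ f x → 0# ≤ fromℕ 2 * Γσ f f x
  2Γσ-nonneg f x = ≤-trans
    (*-nonneg (1/ℕ-nonneg (deg x)) (∑-nonneg (neighbours x) λ y → ²-nonneg (difference f x y)))
    (≤-reflexive (sym (2Γσ≈energy f x)))

  deg≤maxDegree : ∀ x → deg x ℕ.≤ maxDegree
  deg≤maxDegree x = All.lookup (xs≤max 0 (map deg (allFin n))) (∈-map⁺ deg (∈-allFin x))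

  energyDensity≤ : ∀ f {M} → (∀ x → fromℕ 2 * Γσ f f x ≤ M) → ∀ x →
                   energyDensity f x ≤ fromℕ maxDegree * M
  energyDensity≤ f {M} 2Γ≤M x = begin
    energyDensity f x                     ≈⟨ energyDensity≈deg*2Γσ f x ⟩
    fromℕ (deg x) * (fromℕ 2 * Γσ f f x)  ≤⟨ *-monoʳ-≤ (fromℕ-nonneg (deg x)) (2Γ≤M x) ⟩
    fromℕ (deg x) * M                     ≤⟨ *-monoˡ-≤ (≤-trans (2Γσ-nonneg f x) (2Γ≤M x)) (fromℕ-mono (deg≤maxDegree x)) ⟩
    fromℕ maxDegree * M                   ∎

  -- Applied to `g = Δσ f`, which is `- μ` times `f` for an eigenfunction.
  Γσ-scaleʳ : ∀ f g r → (∀ y → g y ≈ r * f y) → ∀ x → Γσ f g x ≈ r * Γσ f f x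
  Γσ-scaleʳ f g r g≈rf x = begin-equality
    ½ * (Δ (λ y → f y * g y) x - g x * Δσ f x - f x * Δσ g x)
      ≈⟨ *-congˡ (+-cong (+-cong
           (trans (laplacian-cong unsigned (λ y → trans (*-congˡ (g≈rf y)) (x*ry (f y))) x) (laplacian-scale unsigned r (λ y → f y * f y) x))
           (-‿cong (*-congʳ (g≈rf x))))
           (-‿cong (*-congˡ (trans (laplacian-cong σ g≈rf x) (laplacian-scale σ r f x))))) ⟩
    ½ * (r * Δ (λ y → f y * f y) x - r * f x * Δσ f x - f x * (r * Δσ f x))
      ≈⟨ solve 5 (λ h r a u l → h :* (r :* a :- r :* u :* l :- u :* (r :* l))
                             := r :* (h :* (a :- u :* l :- u :* l))) refl ½ r _ (f x) (Δσ f x) ⟩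
    r * Γσ f f x ∎
    where
    x*ry : ∀ u → u * (r * u) ≈ r * (u * u)
    x*ry u = solve 2 (λ r u → u :* (r :* u) := r :* (u :* u)) refl r u

  -- Energy along walks.

  walkEnergy : Function → ∀ {x y k} → Walk x y k → ℝ
  walkEnergy f []                        = 0#
  walkEnergy f (_∷_ {x = x} {y = y} _ w) = difference f x y ² + walkEnergy f w

  walkEnergy-nonneg : ∀ f {x y k} (w : Walk x y k) → 0# ≤ walkEnergy f w
  walkEnergy-nonneg f []      = ≤-refl
  walkEnergy-nonneg f (_ ∷ w) = +-nonneg (²-nonneg _) (walkEnergy-nonneg f w)

  -- For `q = k > 0` this is the identity `q((1+q)(a²+e) - (a+b)²) = (qa-b)² + (1+q)(qe-b²)`; for `k
  -- = 0` the hypothesis forces `b` to vanish.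
  cauchy-step : ∀ k {a b e} → 0# ≤ e → b ² ≤ fromℕ k * e → (a + b) ² ≤ fromℕ (suc k) * (a ² + e)
  cauchy-step zero {a} {b} {e} 0≤e b²≤0 = ≤-by 0≤e (begin-equality
    fromℕ 1 * (a ² + e) - (a + b) ²    ≈⟨ +-congˡ (-‿cong (*-cong (+-congˡ b≈0) (+-congˡ b≈0))) ⟩
    fromℕ 1 * (a ² + e) - (a + 0#) ²   ≈⟨ solve 2 (λ a e → :1 :* (a :* a :+ e) :- (a :+ :0) :* (a :+ :0) := e) refl a e ⟩
    e                                  ∎)
    where
    b≈0 : b ≈ 0#
    b≈0 = x²≈0⇒x≈0 (≤-antisym (≤-trans b²≤0 (≤-reflexive (zeroˡ e))) (²-nonneg b))
  cauchy-step (suc k) {a} {b} {e} 0≤e b²≤qe = *-cancelˡ-≤ (fromℕ-pos k)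
    (≤-by (+-nonneg (²-nonneg (q * a - b)) (*-nonneg (fromℕ-nonneg (suc (suc k))) (x≤y⇒y-x≥0 b²≤qe)))
      (trans (+-congʳ (*-congˡ (*-congʳ 1+q))) (trans
        (solve 4 (λ q a b e →
             q :* ((:1 :+ q) :* (a :* a :+ e)) :- q :* ((a :+ b) :* (a :+ b))
          := (q :* a :- b) :* (q :* a :- b) :+ (:1 :+ q) :* (q :* e :- b :* b)) refl q a b e)
        (+-congˡ (*-congʳ (sym 1+q))))))
    where
    q = fromℕ (suc k)
    1+q : fromℕ (suc (suc k)) ≈ fromℕ 1 + q
    1+q = fromℕ-+ 1 (suc k)

  -- Cauchy–Schwarz for the telescoping sum of the differences along the walk.
  walk-difference : ∀ f {x y k} (w : Walk x y k) →
    (f x - (walkSign w · f y)) ² ≤ fromℕ k * walkEnergy f w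
  walk-difference f {x} [] = ≤-reflexive
    (solve 1 (λ a → (a :- a) :* (a :- a) := :0 :* :0) refl (f x))
  walk-difference f {x} {z} {suc k} (_∷_ {y = y} e w) = begin
    (f x - ((σ x y Sign.* walkSign w) · f z)) ²
      ≈⟨ *-cong (telescope (σ x y) (walkSign w) (f x) (f y) (f z)) (telescope (σ x y) (walkSign w) (f x) (f y) (f z)) ⟩
    (difference f x y + (σ x y · (f y - (walkSign w · f z)))) ²
      ≤⟨ cauchy-step k (walkEnergy-nonneg f w)
           (≤-trans (≤-reflexive (·-² (σ x y) _)) (walk-difference f w)) ⟩
    fromℕ (suc k) * walkEnergy f (e ∷ w) ∎
    where
    ·-² : ∀ s a → (s · a) ² ≈ a ²
    ·-² Sign.+ a = refl
    ·-² Sign.- a = solve 1 (λ a → (:- a) :* (:- a) := a :* a) refl a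

    telescope : ∀ s t a b d → a - ((s Sign.* t) · d) ≈ (a - (s · b)) + (s · (b - (t · d)))
    telescope Sign.+ t a b d      = solve 3 (λ a b d → a :- d := a :- b :+ (b :- d)) refl a b (t · d)
    telescope Sign.- Sign.+ a b d = solve 3 (λ a b d → a :- :- d := a :- :- b :+ :- (b :- d)) refl a b d
    telescope Sign.- Sign.- a b d = solve 3 (λ a b d → a :- d := a :- :- b :+ :- (b :- :- d)) refl a b d

  -- The two differences agree up to the factor `- σ x y`, which squaring removes.
  difference-sym : ∀ f {x y} → x ∼ y → difference f x y ² ≈ difference f y x ²
  difference-sym f {x} {y} e with σ x y | σ y x | σ-sym e
  ... | Sign.+ | _ | ≡.refl = solve 2 (λ a b → (a :- b) :* (a :- b) := (b :- a) :* (b :- a)) refl (f x) (f y)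
  ... | Sign.- | _ | ≡.refl = solve 2 (λ a b → (a :- :- b) :* (a :- :- b) := (b :- :- a) :* (b :- :- a)) refl (f x) (f y)

  ∈-neighbours : ∀ {x y} → x ∼ y → y ∈ neighbours x
  ∈-neighbours {x} {y} = ∈-filter⁺ (x ∼?_) (∈-allFin y)

  -- The two edges at every second vertex of the walk cover all its edges.
  walkEnergy≤ : ∀ f {B} → (∀ x → energyDensity f x ≤ B) → ∀ {x y k} (w : Walk x y k) →
                NonBacktracking w → walkEnergy f w ≤ fromℕ ⌈ k /2⌉ * B
  walkEnergy≤ f {B} S≤B [] _ = ≤-reflexive (sym (zeroˡ B))
  -- In odd length the last edge is left over and costs a whole `B`; this is the rounding up in
  -- `⌈ k /2⌉`.
  walkEnergy≤ f {B} S≤B (_∷_ {x = x} {y = y} e []) _ = begin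
    difference f x y ² + 0#   ≈⟨ +-identityʳ _ ⟩
    difference f x y ²        ≤⟨ ∑-term (λ z → ²-nonneg (difference f x z)) (∈-neighbours e) ⟩
    energyDensity f x         ≤⟨ S≤B x ⟩
    B                         ≈⟨ solve 1 (λ b → b := :1 :* b) refl B ⟩
    fromℕ 1 * B               ∎
  walkEnergy≤ f {B} S≤B {k = suc (suc k)} (_∷_ {x = x} {y = y} e (_∷_ {y = z} e′ w)) (x≢z , nb) = begin
    difference f x y ² + (difference f y z ² + walkEnergy f w)
      ≈⟨ +-assoc _ _ _ ⟨
    difference f x y ² + difference f y z ² + walkEnergy f w
      ≈⟨ +-congʳ (+-congʳ (difference-sym f e)) ⟩
    difference f y x ² + difference f y z ² + walkEnergy f w
      ≤⟨ +-mono-≤ (≤-trans (∑-two-terms (λ u → ²-nonneg (difference f y u)) x≢z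
                              (∈-neighbours (∼-sym e)) (∈-neighbours e′)) (S≤B y))
                  (walkEnergy≤ f S≤B w (tail-nonBacktracking e′ w nb)) ⟩
    B + fromℕ ⌈ k /2⌉ * B
      ≈⟨ solve 2 (λ b m → b :+ m :* b := (:1 :+ m) :* b) refl B _ ⟩
    (fromℕ 1 + fromℕ ⌈ k /2⌉) * B
      ≈⟨ *-congʳ (fromℕ-+ 1 ⌈ k /2⌉) ⟨
    fromℕ (suc ⌈ k /2⌉) * B ∎

  -- A signed form of a sign change: transported along `w`, the value at `x` is zero or opposite in
  -- sign to `f v`.
  NonpositiveWithin : Function → Fin n → ℕ → Set ℓ₂
  NonpositiveWithin f v L =
    ∃[ x ] ∃[ k ] ∃[ w ] k ℕ.≤ L × (walkSign {x} {v} {k} w · f x) * f v ≤ 0#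

  -- With `s` the sign of the walk, `(a - s b)² - b² = a² - 2 s a b`, and the sign condition makes
  -- both terms nonnegative. The square is then bounded by the energy of the walk.
  square≤ : ∀ f {v L B} → NonpositiveWithin f v L → (∀ x → energyDensity f x ≤ B) →
            f v ² ≤ fromℕ (L ℕ.* ⌈ L /2⌉) * B
  -- Reduction keeps the sign, hence the sign condition, and makes `walkEnergy≤` applicable.
  square≤ f {v} {L} {B} (x , k , w₀ , k≤L , neg) S≤B with reduce w₀
  ... | l , w , l≤k , s≡ , nb = begin
    f v ²                                  ≤⟨ ≤-by (+-nonneg (²-nonneg (f x)) (*-nonneg (fromℕ-nonneg 2) (x≤y⇒y-x≥0 neg′)))
                                                (expand (walkSign w) (f x) (f v)) ⟩
    (f x - (walkSign w · f v)) ²           ≤⟨ walk-difference f w ⟩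
    fromℕ l * walkEnergy f w               ≤⟨ *-monoʳ-≤ (fromℕ-nonneg l) (walkEnergy≤ f S≤B w nb) ⟩
    fromℕ l * (fromℕ ⌈ l /2⌉ * B)          ≈⟨ *-assoc _ _ _ ⟨
    fromℕ l * fromℕ ⌈ l /2⌉ * B            ≈⟨ *-congʳ (fromℕ-* l ⌈ l /2⌉) ⟨
    fromℕ (l ℕ.* ⌈ l /2⌉) * B              ≤⟨ *-monoˡ-≤ 0≤B (fromℕ-mono (ℕ.*-mono-≤ l≤L (ℕ.⌈n/2⌉-mono l≤L))) ⟩
    fromℕ (L ℕ.* ⌈ L /2⌉) * B              ∎
    where
    l≤L : l ℕ.≤ L
    l≤L = ℕ.≤-trans l≤k k≤L

    0≤B : 0# ≤ B
    0≤B = ≤-trans (∑-nonneg (neighbours x) λ y → ²-nonneg (difference f x y)) (S≤B x)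

    neg′ : (walkSign w · f x) * f v ≤ 0#
    neg′ = ≡.subst (λ s → (s · f x) * f v ≤ 0#) (≡.sym s≡) neg

    expand : ∀ s a b → (a - (s · b)) ² - b ² ≈ a ² + fromℕ 2 * (0# - (s · a) * b)
    expand Sign.+ = solve 2 (λ a b → (a :- b) :* (a :- b) :- b :* b
                                  := a :* a :+ :2 :* (:0 :- a :* b)) refl
    expand Sign.- = solve 2 (λ a b → (a :- :- b) :* (a :- :- b) :- b :* b
                                  := a :* a :+ :2 :* (:0 :- (:- a) :* b)) refl

-- Curvature identities for an eigenfunction.

module Eigenfunctions {c ℓ₁ ℓ₂} (R : RealNumbers c ℓ₁ ℓ₂) {n} (G : SignedGraph n) where
  open RealNumbers R
  open OrderedField R
  open SignedGraph G
  open Walks G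
  open SignedLaplacian R G
  open Estimates R G
  open PosetReasoning ≤-poset hiding (step-<)

  module _ {μ f} (eigen : IsEigenfunction μ f) where
    private
      Γ : Function
      Γ = Γσ f f

    Δσ-eigen : ∀ x → Δσ f x ≈ - μ * f x
    Δσ-eigen x = begin-equality
      Δσ f x        ≈⟨ solve 1 (λ a → a := :- :- a) refl _ ⟩
      - - Δσ f x    ≈⟨ -‿cong (eigen x) ⟩
      - (μ * f x)   ≈⟨ solve 2 (λ m a → :- (m :* a) := (:- m) :* a) refl μ (f x) ⟩
      - μ * f x     ∎

    Δ-square : ∀ x → Δ (λ y → f y * f y) x ≈ fromℕ 2 * Γ x - fromℕ 2 * (μ * f x ²)
    Δ-square x = begin-equality
      Δ f² x
        ≈⟨ solve 3 (λ l a u → l := (l :- a :* u :- a :* u) :+ :2 :* (a :* u)) refl (Δ f² x) (f x) (Δσ f x) ⟩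
      (Δ f² x - f x * Δσ f x - f x * Δσ f x) + fromℕ 2 * (f x * Δσ f x)
        ≈⟨ +-cong (sym (2Γσ f f x)) (*-congˡ (*-congˡ (Δσ-eigen x))) ⟩
      fromℕ 2 * Γ x + fromℕ 2 * (f x * (- μ * f x))
        ≈⟨ solve 3 (λ g m a → g :+ :2 :* (a :* ((:- m) :* a)) := g :- :2 :* (m :* (a :* a))) refl _ μ (f x) ⟩
      fromℕ 2 * Γ x - fromℕ 2 * (μ * f x ²) ∎
      where
      f² : Function
      f² y = f y * f y

    Γ₂σ-eigen : ∀ x → fromℕ 2 * Γ₂σ f f x ≈ Δ Γ x + fromℕ 2 * (μ * Γ x)
    Γ₂σ-eigen x = begin-equality
      fromℕ 2 * Γ₂σ f f x
        ≈⟨ double-half _ ⟩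
      Δ Γ x - Γσ f (Δσ f) x - Γσ f (Δσ f) x
        ≈⟨ +-cong (+-congˡ (-‿cong Γ-Δσ)) (-‿cong Γ-Δσ) ⟩
      Δ Γ x - - μ * Γ x - - μ * Γ x
        ≈⟨ solve 3 (λ l m g → l :- (:- m) :* g :- (:- m) :* g := l :+ :2 :* (m :* g)) refl _ μ (Γ x) ⟩
      Δ Γ x + fromℕ 2 * (μ * Γ x) ∎
      where
      Γ-Δσ : Γσ f (Δσ f) x ≈ - μ * Γ x
      Γ-Δσ = Γσ-scaleʳ f (Δσ f) (- μ) Δσ-eigen x

    -- For an eigenfunction `2 Γ₂ = Δ Γ + 2 μ Γ`, so the curvature condition turns into a lower
    -- bound for `Δ Γ`.
    bochner : ∀ {K N} → CDσ K N → ∀ x →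
      fromℕ 2 * (1/∞ N * (μ ² * f x ²) + (K - μ) * Γ x) ≤ Δ Γ x
    bochner {K} {N} cd x = ≤-by (*-nonneg (fromℕ-nonneg 2) (x≤y⇒y-x≥0 (cd f x))) (begin-equality
      Δ Γ x - fromℕ 2 * (1/∞ N * (μ ² * f x ²) + (K - μ) * Γ x)
        ≈⟨ solve 6 (λ l r m a k g →
               l :- :2 :* (r :* ((m :* m) :* (a :* a)) :+ (k :- m) :* g)
            := (l :+ :2 :* (m :* g)) :- :2 :* (r :* (((:- m) :* a) :* ((:- m) :* a)) :+ k :* g))
            refl (Δ Γ x) (1/∞ N) μ (f x) K (Γ x) ⟩
      (Δ Γ x + fromℕ 2 * (μ * Γ x)) - fromℕ 2 * (1/∞ N * (- μ * f x) ² + K * Γ x)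
        ≈⟨ +-cong (sym (Γ₂σ-eigen x)) (-‿cong (*-congˡ (+-congʳ (*-congˡ (sym (*-cong (Δσ-eigen x) (Δσ-eigen x))))))) ⟩
      fromℕ 2 * Γ₂σ f f x - fromℕ 2 * (1/∞ N * Δσ f x ² + K * Γ x)
        ≈⟨ solve 2 (λ a b → :2 :* a :- :2 :* b := :2 :* (a :- b)) refl _ _ ⟩
      fromℕ 2 * (Γ₂σ f f x - (1/∞ N * Δσ f x ² + K * Γ x)) ∎)

    -- Gradient and eigenvalue estimates.

    module _ {v} (0<f²v : 0# < f v ²) (max : ∀ x → f x ² ≤ f v ²) where

      -- At the maximum of `f²`, `0 ≥ Δ f² = 2 Γ - 2 μ f²` with `Γ ≥ 0`.
      eigenvalue-nonneg : 0# ≤ μ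
      eigenvalue-nonneg = *-cancelʳ-≤ 0<f²v (begin
        0# * f v ²   ≈⟨ zeroˡ _ ⟩
        0#           ≤⟨ 0≤μf² ⟩
        μ * f v ²    ∎)
        where
        0≤μf² : 0# ≤ μ * f v ²
        0≤μf² = *-cancelˡ-≤ (fromℕ-pos 1) (≤-by
          (+-nonneg (2Γσ-nonneg f v) (x≤y⇒y-x≥0 (maximum-principle (λ y → f y * f y) v max)))
          (trans (solve 2 (λ a g → :2 :* a :- :2 :* :0 := g :+ (:0 :- (g :- :2 :* a))) refl _ (fromℕ 2 * Γ v))
            (+-congˡ (+-congˡ (-‿cong (sym (Δ-square v)))))))

      -- If `μ < K`, then at a maximum of `Γ` the curvature bound gives `(K - μ) Γ ≤ 0`, so `Γ`
      -- vanishes everywhere. The walk in `near` then yields `f v ² ≤ 0`.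
      curvature≤eigenvalue : ∀ {K N L} → CDσ K N → NonpositiveWithin f v L → K ≤ μ
      curvature≤eigenvalue {K} {N} {L} cd near μ<K = ¬¬-maximum v Γ λ (u , Γmax) →
        let
          Γ≤0 : Γ u ≤ 0#
          Γ≤0 = *-cancelˡ-≤ (x<y⇒0<y-x μ<K) (*-cancelˡ-≤ (fromℕ-pos 1) (begin
            fromℕ 2 * ((K - μ) * Γ u)
              ≤⟨ *-monoʳ-≤ (fromℕ-nonneg 2) (≤-by
                   (*-nonneg (1/∞-nonneg N) (*-nonneg (²-nonneg μ) (²-nonneg (f u))))
                   (solve 2 (λ a b → a :+ b :- b := a) refl _ _)) ⟩
            fromℕ 2 * (1/∞ N * (μ ² * f u ²) + (K - μ) * Γ u)
              ≤⟨ bochner {K} {N} cd u ⟩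
            Δ Γ u
              ≤⟨ maximum-principle Γ u Γmax ⟩
            0#
              ≈⟨ solve 1 (λ a → :0 := :2 :* (a :* :0)) refl (K - μ) ⟩
            fromℕ 2 * ((K - μ) * 0#) ∎))

          2Γ≤0 : ∀ x → fromℕ 2 * Γ x ≤ 0#
          2Γ≤0 x = ≤-trans (*-monoʳ-≤ (fromℕ-nonneg 2) (≤-trans (Γmax x) Γ≤0)) (≤-reflexive (zeroʳ _))
        in
        (begin
          f v ²                                                      ≤⟨ square≤ f near (energyDensity≤ f 2Γ≤0) ⟩
          fromℕ (L ℕ.* ⌈ L /2⌉) * (fromℕ maxDegree * 0#)             ≈⟨ solve 2 (λ a b → a :* (b :* :0) := :0) refl _ _ ⟩
          0#                                                         ∎) 0<f²v

      module _ {ε K : ℝ} (0<ε : 0# < ε) (N : ⟨0,∞]) where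
        private
          A P : ℝ
          A = (fromℕ 2 + ε) * μ - fromℕ 2 * K
          P = [2+ ε ]²-4/ N * μ - fromℕ 2 * (fromℕ 2 + ε) * K

          F : Function
          F x = fromℕ 2 * Γ x + A * (f x * f x)

        -- A f² is the summand that makes the coefficient of Γ at a maximum of
        -- F equal to 2εμ, whatever the sign of K.
        F-maximum : CDσ K N → 0# < μ → ∀ {u} → (∀ x → F x ≤ F u) → ε * F u ≤ P * f u ²
        -- As `P = (2 + ε) A - 4 κ μ`, right side minus left side is `- 2` times the quantity in
        -- `bound`.
        F-maximum cd 0<μ {u} Fmax = ≤-by (*-nonneg (fromℕ-nonneg 2) (x≤y⇒y-x≥0 bound))
          (solve 6 (λ e k r m g a →
               (((:2 :+ e) :* (:2 :+ e) :- :4 :* r) :* m :- :2 :* (:2 :+ e) :* k) :* (a :* a)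
               :- e :* (:2 :* g :+ ((:2 :+ e) :* m :- :2 :* k) :* (a :* a))
            := :2 :* (:0 :- (:2 :* (r :* (m :* (a :* a))) :+ e :* g :- ((:2 :+ e) :* m :- :2 :* k) :* (a :* a))))
            refl ε K (1/∞ N) μ (Γ u) (f u))
          where
          κ : ℝ
          κ = 1/∞ N
          q = f u ²
          -- The curvature bound for `Δ F u` is `2 μ` times this quantity: the coefficient
          -- `4 (K - μ) + 2 A` of `Γ u` collapses to `2 ε μ`.
          bound : fromℕ 2 * (κ * (μ * q)) + ε * Γ u - A * q ≤ 0#
          bound = *-cancelˡ-≤ 0<μ (*-cancelˡ-≤ (fromℕ-pos 1) (begin
            fromℕ 2 * (μ * (fromℕ 2 * (κ * (μ * q)) + ε * Γ u - A * q))
              ≈⟨ solve 6 (λ e k r m g a →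
                   :2 :* (m :* (:2 :* (r :* (m :* a)) :+ e :* g :- ((:2 :+ e) :* m :- :2 :* k) :* a))
                   := :2 :* (:2 :* (r :* ((m :* m) :* a) :+ (k :- m) :* g))
                      :+ ((:2 :+ e) :* m :- :2 :* k) :* (:2 :* g :- :2 :* (m :* a)))
                   refl ε K κ μ (Γ u) q ⟩
            fromℕ 2 * (fromℕ 2 * (κ * (μ ² * q) + (K - μ) * Γ u)) + A * (fromℕ 2 * Γ u - fromℕ 2 * (μ * q))
              ≤⟨ +-mono-≤ (*-monoʳ-≤ (fromℕ-nonneg 2) (bochner {K} {N} cd u))
                          (≤-reflexive (*-congˡ (sym (Δ-square u)))) ⟩
            fromℕ 2 * Δ Γ u + A * Δ (λ y → f y * f y) u
              ≈⟨ laplacian-linear unsigned (fromℕ 2) A Γ (λ y → f y * f y) u ⟨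
            Δ F u
              ≤⟨ maximum-principle F u Fmax ⟩
            0#
              ≈⟨ solve 1 (λ m → :0 := :2 :* (m :* :0)) refl μ ⟩
            fromℕ 2 * (μ * 0#) ∎))

        -- Dropping `A f²` from `F` needs `A ≥ 0`, and passing from the maximum `u` of `F` to the
        -- maximum `v` of `f²` needs `P ≥ 0`; both rest on `K ≤ μ`.
        gradient-estimate : CDσ K N → 0# < μ → K ≤ μ → ∀ x → ε * (fromℕ 2 * Γ x) ≤ P * f v ²
        gradient-estimate cd 0<μ K≤μ x contra = ¬¬-maximum v F λ (u , Fmax) →
          let
            εF≤P : ∀ y → ε * F y ≤ P * f u ²
            εF≤P y = ≤-trans (*-monoʳ-≤ (<⇒≤ 0<ε) (Fmax y)) (F-maximum cd 0<μ Fmax)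

            -- A negative `P` would give `F v ≤ 0`, whereas `F v ≥ A * f v ² ≥ ε * μ * f v ² > 0`.
            0≤P : 0# ≤ P
            0≤P P<0 = (begin
              ε * (ε * μ) * f v ²   ≤⟨ *-monoˡ-≤ (<⇒≤ 0<f²v) (*-monoʳ-≤ (<⇒≤ 0<ε) εμ≤A) ⟩
              ε * A * f v ²         ≈⟨ *-assoc _ _ _ ⟩
              ε * (A * f v ²)       ≤⟨ *-monoʳ-≤ (<⇒≤ 0<ε) (≤-by (2Γσ-nonneg f v)
                                         (solve 2 (λ a b → a :+ b :- b := a) refl _ _)) ⟩
              ε * F v               ≤⟨ εF≤P v ⟩
              P * f u ²             ≤⟨ *-monoˡ-≤ (²-nonneg (f u)) (<⇒≤ P<0) ⟩
              0# * f u ²            ≈⟨ zeroˡ _ ⟩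
              0#                    ∎) (*-pos (*-pos 0<ε (*-pos 0<ε 0<μ)) 0<f²v)
          in
          (begin
            ε * (fromℕ 2 * Γ x)   ≤⟨ *-monoʳ-≤ (<⇒≤ 0<ε) (≤-by (*-nonneg 0≤A (²-nonneg (f x)))
                                       (solve 2 (λ a b → a :+ b :- a := b) refl _ _)) ⟩
            ε * F x               ≤⟨ εF≤P x ⟩
            P * f u ²             ≤⟨ *-monoʳ-≤ 0≤P (max u) ⟩
            P * f v ²             ∎) contra
          where
          εμ≤A : ε * μ ≤ A
          εμ≤A = ≤-by (*-nonneg (fromℕ-nonneg 2) (x≤y⇒y-x≥0 K≤μ))
            (solve 3 (λ e m k → (:2 :+ e) :* m :- :2 :* k :- e :* m := :2 :* (m :- k)) refl ε μ K)

          0≤A : 0# ≤ A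
          0≤A = ≤-trans (*-nonneg (<⇒≤ 0<ε) (<⇒≤ 0<μ)) εμ≤A

        -- With `2 Γ` bounded by `P * f v ² / ε`, `square≤` has the factor `f v ²` on both sides,
        -- and it cancels.
        eigenvalue-estimate : CDσ K N → 0# < μ → ∀ {L} → NonpositiveWithin f v L →
          ε ≤ fromℕ (maxDegree *ℕ L *ℕ ⌈ L /2⌉) * P
        eigenvalue-estimate cd 0<μ {L} near = *-cancelʳ-≤ 0<f²v (begin
          ε * f v ²
            ≤⟨ *-monoʳ-≤ (<⇒≤ 0<ε) (square≤ f near (energyDensity≤ f 2Γ≤)) ⟩
          ε * (fromℕ (L ℕ.* ⌈ L /2⌉) * (fromℕ maxDegree * (recip ε 0<ε * (P * f v ²))))
            ≈⟨ solve 6 (λ e l d r p a → e :* (l :* (d :* (r :* (p :* a)))) := (e :* r) :* ((d :* l) :* p :* a))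
                 refl ε _ _ (recip ε 0<ε) P (f v ²) ⟩
          ε * recip ε 0<ε * (fromℕ maxDegree * fromℕ (L ℕ.* ⌈ L /2⌉) * P * f v ²)
            ≈⟨ *-cong (recip-inverse ε 0<ε) (*-congʳ (*-congʳ (sym (fromℕ-* maxDegree _)))) ⟩
          1# * (fromℕ (maxDegree ℕ.* (L ℕ.* ⌈ L /2⌉)) * P * f v ²)
            ≈⟨ *-identityˡ _ ⟩
          fromℕ (maxDegree ℕ.* (L ℕ.* ⌈ L /2⌉)) * P * f v ²
            ≡⟨ ≡.cong (λ m → fromℕ m * P * f v ²) (ℕ.*-assoc maxDegree L _) ⟨
          fromℕ (maxDegree *ℕ L *ℕ ⌈ L /2⌉) * P * f v ² ∎)
          where
          2Γ≤ : ∀ x → fromℕ 2 * Γ x ≤ recip ε 0<ε * (P * f v ²)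
          2Γ≤ x = *-cancelˡ-≤ 0<ε (begin
            ε * (fromℕ 2 * Γ x)                 ≤⟨ gradient-estimate cd 0<μ (curvature≤eigenvalue {K} {N} cd near) x ⟩
            P * f v ²                           ≈⟨ *-identityˡ _ ⟨
            1# * (P * f v ²)                    ≈⟨ *-congʳ (recip-inverse ε 0<ε) ⟨
            ε * recip ε 0<ε * (P * f v ²)       ≈⟨ *-assoc _ _ _ ⟩
            ε * (recip ε 0<ε * (P * f v ²))     ∎)

    -- Switching by s turns f into an eigenfunction of Δ, which violates the
    -- minimum principle if it is positive.
    switched-not-positive : 0# < μ → Fin n → ∀ r (s : Fin n → Sign) →
      (∀ {x y} → x ∼ y → s x ≡ σ x y Sign.* s y) →
      ¬ (∀ x → ¬ ((s x · f x) * r ≤ 0#))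
    switched-not-positive 0<μ x₀ r s compatible positive =
      -- A minimum `v` of `g` is sought as a maximum of `- g`; there `μ * g v = - Δ g v ≤ 0`,
      -- against `positive v`.
      ¬¬-maximum x₀ (λ x → - g x) λ (v , max) → positive v (*-cancelˡ-≤ 0<μ (begin
        μ * g v                             ≈⟨ solve 2 (λ m a → m :* a := :0 :- (:- m) :* a) refl μ (g v) ⟩
        0# - - μ * g v                      ≈⟨ +-congˡ (-‿cong (Δg v)) ⟨
        0# - Δ g v                          ≤⟨ +-mono-≤ ≤-refl (-‿mono-≤ (minimum-principle g v λ y →
                                                 ≤-by (x≤y⇒y-x≥0 (max y)) (solve 2 (λ a b → b :- a := :- a :- :- b) refl (g v) (g y)))) ⟩
        0# - 0#                             ≈⟨ solve 1 (λ m → :0 :- :0 := m :* :0) refl μ ⟩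
        μ * 0#                              ∎))
      where
      -- The factor `r` fixes the overall sign; it is taken to be the value of `f` at its reference
      -- vertex.
      g : Function
      g x = (s x · f x) * r

      pull : ∀ s a → (s · a) * r ≈ (s · 1#) * r * a
      pull Sign.+ a = trans (*-congʳ (sym (*-identityˡ a))) (solve 3 (λ o a r → o :* a :* r := o :* r :* a) refl 1# a r)
      pull Sign.- a = trans (*-congʳ (-‿cong (sym (*-identityˡ a))))
        (solve 3 (λ o a r → :- (o :* a) :* r := (:- o) :* r :* a) refl 1# a r)

      -- As `p² = 1`, the sign `t` equals `(p * t) * p`, which allows `p * t` to be pulled out.
      switch : ∀ p t a b → (t · a) * r - ((p Sign.* t) · b) * r ≈ (((p Sign.* t) · ((p · a) - b))) * r
      switch Sign.+ Sign.+ = solve 3 (λ r a b → a :* r :- b :* r := (a :- b) :* r) refl r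
      switch Sign.+ Sign.- = solve 3 (λ r a b → (:- a) :* r :- (:- b) :* r := (:- (a :- b)) :* r) refl r
      switch Sign.- Sign.+ = solve 3 (λ r a b → a :* r :- (:- b) :* r := (:- (:- a :- b)) :* r) refl r
      switch Sign.- Sign.- = solve 3 (λ r a b → (:- a) :* r :- b :* r := (:- a :- b) :* r) refl r

      Δg : ∀ v → Δ g v ≈ - μ * g v
      Δg v = begin-equality
        Δ g v
          ≈⟨ *-congˡ (∑-cong (neighbours v) (λ y∈ → term (proj₂ (∈-filter⁻ (v ∼?_) {xs = allFin n} y∈)))) ⟩
        1/ℕ (deg v) * ∑ (map (λ y → (s v · 1#) * r * ((σ v y · f y) - f v)) (neighbours v))
          ≈⟨ *-congˡ (∑-scale (neighbours v) _ _) ⟩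
        1/ℕ (deg v) * ((s v · 1#) * r * ∑ (map (λ y → (σ v y · f y) - f v) (neighbours v)))
          ≈⟨ solve 3 (λ d a b → d :* (a :* b) := a :* (d :* b)) refl _ _ _ ⟩
        (s v · 1#) * r * Δσ f v
          ≈⟨ *-congˡ (Δσ-eigen v) ⟩
        (s v · 1#) * r * (- μ * f v)
          ≈⟨ solve 3 (λ a m b → a :* (m :* b) := m :* (a :* b)) refl _ _ _ ⟩
        - μ * ((s v · 1#) * r * f v)
          ≈⟨ *-congˡ (pull (s v) (f v)) ⟨
        - μ * g v ∎
        where
        term : ∀ {y} → v ∼ y → g y - g v ≈ (s v · 1#) * r * ((σ v y · f y) - f v)
        term {y} e = trans
          (≡.subst (λ t → (s y · f y) * r - (t · f v) * r ≈ (t · ((σ v y · f y) - f v)) * r)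
            (≡.sym (compatible e)) (switch (σ v y) (s y) (f y) (f v)))
          (pull (s v) _)

    -- Existence of walks with the required sign.

    -- If no such walk existed, all walks from `x` to `v` of length at most `D + 1` would carry one
    -- sign, that of `f x * f v`. Comparing the chosen walk from `x` with an edge to `y` followed by
    -- the chosen walk from `y` makes the signs compatible; that edge costs the extra `1`.
    nonpositive-within-1+D : 0# < μ → ∀ {D} → Connected → IsDiameter D → ∀ v →
      ¬ ¬ NonpositiveWithin f v (suc D)
    nonpositive-within-1+D 0<μ {D} connected diameter v none =
      walks-within-diameter connected diameter v λ walks →
      switched-not-positive 0<μ v (f v) (λ x → walkSign (proj₂ (proj₂ (walks x))))
        (λ {x} {y} e → let (k , k≤D , w) = walks x ; (l , l≤D , u) = walks y in
          same-sign _ _ (f x) (f v)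
            (λ neg → none (x , k , w , ℕ.m≤n⇒m≤1+n k≤D , neg))
            (λ neg → none (x , suc l , e ∷ u , s≤s l≤D , neg)))
        λ x neg → let (k , k≤D , w) = walks x in none (x , k , w , ℕ.m≤n⇒m≤1+n k≤D , neg)
      where
      same-sign : ∀ p q a b → ¬ ((p · a) * b ≤ 0#) → ¬ ((q · a) * b ≤ 0#) → p ≡ q
      same-sign Sign.+ Sign.+ a b _ _ = ≡.refl
      same-sign Sign.- Sign.- a b _ _ = ≡.refl
      same-sign Sign.+ Sign.- a b p q = ⊥-elim (p λ 0<ab → q (≤-by (<⇒≤ 0<ab)
        (solve 2 (λ a b → :0 :- (:- a) :* b := a :* b) refl a b)))
      same-sign Sign.- Sign.+ a b p q = ⊥-elim (q λ 0<ab → p (≤-by (<⇒≤ 0<ab)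
        (solve 2 (λ a b → :0 :- (:- a) :* b := a :* b) refl a b)))

    -- Balance alone makes the signs compatible, so the prolonged walk need not obey a length bound
    -- and `D` suffices.
    nonpositive-balanced : 0# < μ → Balanced → ∀ {D} → Connected → IsDiameter D → ∀ v →
      ¬ ¬ NonpositiveWithin f v D
    nonpositive-balanced 0<μ balanced connected diameter v none =
      walks-within-diameter connected diameter v λ walks →
      switched-not-positive 0<μ v (f v) (λ x → walkSign (proj₂ (proj₂ (walks x))))
        (λ {x} {y} e → walkSign-unique balanced (proj₂ (proj₂ (walks x))) (e ∷ proj₂ (proj₂ (walks y))))
        λ x neg → let (k , k≤D , w) = walks x in none (x , k , w , k≤D , neg)

  nonpositive-at-zero : ∀ {f z} → f z ≈ 0# → ∀ {D} → Connected → IsDiameter D → ∀ v →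
    ¬ ¬ NonpositiveWithin f v D
  nonpositive-at-zero {f} {z} fz≈0 connected diameter v none =
    walks-within-diameter connected diameter v λ walks →
    let (k , k≤D , w) = walks z in
    none (z , k , w , k≤D , ≤-reflexive (trans (*-congʳ (·0 (walkSign w))) (zeroˡ (f v))))
    where
    ·0 : ∀ s → s · f z ≈ 0#
    ·0 Sign.+ = fz≈0
    ·0 Sign.- = trans (-‿cong fz≈0) (solve 0 (:- :0 := :0) refl)

  -- The combination `f₂ z * f₁ - f₁ z * f₂` of two independent eigenfunctions vanishes at `z`.
  eigenfunction-vanishing-at : ∀ {μ} → Multiplicity≥ 2 μ → ∀ z →
    ¬ ¬ (∃[ f ] IsEigenfunction μ f × ¬ (∀ x → f x ≈ 0#) × f z ≈ 0#)
  eigenfunction-vanishing-at {μ} (fs , eigen , independent) z none =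
    none (h , h-eigen , h-nonzero , solve 2 (λ a b → b :* a :+ :- a :* b := :0) refl (f₁ z) (f₂ z))
    where
    f₁ f₂ h : Function
    f₁ = fs Fin.zero
    f₂ = fs (Fin.suc Fin.zero)
    h x = f₂ z * f₁ x + - f₁ z * f₂ x

    h-eigen : IsEigenfunction μ h
    h-eigen x = begin-equality
      - Δσ h x
        ≈⟨ -‿cong (laplacian-linear σ (f₂ z) (- f₁ z) f₁ f₂ x) ⟩
      - (f₂ z * Δσ f₁ x + - f₁ z * Δσ f₂ x)
        ≈⟨ solve 4 (λ a b u v → :- (a :* u :+ b :* v) := a :* (:- u) :+ b :* (:- v)) refl _ _ _ _ ⟩
      f₂ z * - Δσ f₁ x + - f₁ z * - Δσ f₂ x
        ≈⟨ +-cong (*-congˡ (eigen Fin.zero x)) (*-congˡ (eigen (Fin.suc Fin.zero) x)) ⟩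
      f₂ z * (μ * f₁ x) + - f₁ z * (μ * f₂ x)
        ≈⟨ solve 5 (λ m a b u v → a :* (m :* u) :+ b :* (m :* v) := m :* (a :* u :+ b :* v)) refl μ _ _ _ _ ⟩
      μ * h x ∎

    combination : ℝ → ℝ → Fin 2 → ℝ
    combination a b Fin.zero           = a
    combination a b (Fin.suc Fin.zero) = b

    h-nonzero : ¬ (∀ x → h x ≈ 0#)
    -- If `h` were identically zero, independence would kill its coefficients; then `f₁ z ≈ 0#` and
    -- `f₁` itself serves as witness.
    h-nonzero h≈0 = none (f₁ , eigen Fin.zero , f₁-nonzero , f₁z≈0)
      where
      coefficients≈0 : ∀ i → combination (f₂ z) (- f₁ z) i ≈ 0#
      coefficients≈0 = independent _ λ x → trans (+-congˡ (+-identityʳ _)) (h≈0 x)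

      f₁z≈0 : f₁ z ≈ 0#
      f₁z≈0 = trans (solve 1 (λ a → a := :- :- a) refl (f₁ z))
        (trans (-‿cong (coefficients≈0 (Fin.suc Fin.zero))) (solve 0 (:- :0 := :0) refl))

      f₁-nonzero : ¬ (∀ x → f₁ x ≈ 0#)
      f₁-nonzero f₁≈0 = <-irrefl (sym (independent (combination 1# 0#)
        (λ x → trans (+-cong (*-congˡ (f₁≈0 x)) (trans (+-identityʳ _) (zeroˡ _)))
                     (trans (+-identityʳ _) (zeroʳ 1#))) Fin.zero)) 0<1

  ¬¬-maximum-square : ∀ (f : Function) → Fin n → ¬ (∀ x → f x ≈ 0#) →
    ¬ ¬ (∃[ v ] 0# < f v ² × (∀ x → f x ² ≤ f v ²))
  ¬¬-maximum-square f x₀ f≉0 none = ¬¬-maximum x₀ (λ x → f x ²) λ (v , max) →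
    nonneg⇒¬¬pos (²-nonneg (f v))
      (λ f²v≈0 → f≉0 λ x → x²≈0⇒x≈0 (≤-antisym (≤-trans (max x) (≤-reflexive f²v≈0)) (²-nonneg (f x))))
      λ 0<f²v → none (v , 0<f²v , max)

  -- Solving the estimate for the eigenvalue.

  scaled-estimate : ∀ {ε Q μ K} (0<ε : 0# < ε) (0<Q : 0# < Q) C →
    ε ≤ fromℕ C * (Q * μ - fromℕ 2 * (fromℕ 2 + ε) * K) →
    (ε / Q ⟨ 0<Q ⟩) * (1/ℕ C) + ((fromℕ 2 * (fromℕ 2 + ε)) / Q ⟨ 0<Q ⟩) * K ≤ μ
  -- The default value `1/ℕ 0` is never met: for `C = 0` the hypothesis says `ε ≤ 0`.
  scaled-estimate 0<ε 0<Q zero ε≤0 = ⊥-elim (≤-trans ε≤0 (≤-reflexive (zeroˡ _)) 0<ε)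
  scaled-estimate {ε} {Q} {μ} {K} 0<ε 0<Q (suc m) ε≤CP = begin
    ε * q * c′ + fromℕ 2 * (fromℕ 2 + ε) * q * K
      ≤⟨ +-mono-≤ (*-monoˡ-≤ (1/ℕ-nonneg (suc m)) (*-monoˡ-≤ (<⇒≤ (recip-pos Q 0<Q)) ε≤CP)) ≤-refl ⟩
    fromℕ (suc m) * (Q * μ - T * K) * q * c′ + T * q * K
      ≈⟨ +-congʳ (solve 4 (λ n p q c → n :* p :* q :* c := (n :* c) :* (p :* q)) refl (fromℕ (suc m)) (Q * μ - T * K) q c′) ⟩
    fromℕ (suc m) * c′ * ((Q * μ - T * K) * q) + T * q * K
      ≈⟨ +-congʳ (trans (*-congʳ (recip-inverse _ (fromℕ-pos m))) (*-identityˡ _)) ⟩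
    (Q * μ - T * K) * q + T * q * K
      ≈⟨ solve 5 (λ Q q m t k → (Q :* m :- t :* k) :* q :+ t :* q :* k := (Q :* q) :* m) refl Q q μ T K ⟩
    Q * q * μ
      ≈⟨ *-congʳ (recip-inverse Q 0<Q) ⟩
    1# * μ
      ≈⟨ *-identityˡ μ ⟩
    μ ∎
    where
    q = recip Q 0<Q
    c′ = 1/ℕ suc m
    T = fromℕ 2 * (fromℕ 2 + ε)

theorem3p4 :
    ∀ {c ℓ₁ ℓ₂} (R : RealNumbers c ℓ₁ ℓ₂) {n : ℕ} (G : SignedGraph n) →
    let open RealNumbers R
        open SignedGraph G
        open SignedLaplacian R G
        d = maxDegree
    in
    (ε : ℝ) (ε>0 : 0# < ε) →
    Connected →
    (K : ℝ) (N : ⟨0,∞]) → CDσ K N →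
    (N-large : fromℕ 4 / [2+ ε ]² ⟨ [2+ε]²-pos ε>0 ⟩ <∞ N) →
    (D : ℕ) → IsDiameter D →
    (λσ : ℝ) → IsEigenvalue λσ → ¬ (λσ ≈ 0#) →
    let Q   = [2+ ε ]²-4/ N
        Q>0 = [2+ε]²-4/N-pos ε>0 N N-large
        K-term = ((fromℕ 2 * (fromℕ 2 + ε)) / Q ⟨ Q>0 ⟩) * K
    in
    ((ε / Q ⟨ Q>0 ⟩) * (1/ℕ (d *ℕ suc D *ℕ ⌈ suc D /2⌉)) + K-term ≤ λσ)
    ×
    (Multiplicity≥ 2 λσ ⊎ Balanced →
     (ε / Q ⟨ Q>0 ⟩) * (1/ℕ (d *ℕ D *ℕ ⌈ D /2⌉)) + K-term ≤ λσ)
theorem3p4 R {n} G ε ε>0 connected K N cd N-large D diameter λσ (f , f-eigen , f≉0) λσ≉0 =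
  bound f f-eigen f≉0 (suc D) (λ v 0<λσ → nonpositive-within-1+D f-eigen 0<λσ connected diameter v) ,
  λ where
    (inj₂ balanced) →
      bound f f-eigen f≉0 D λ v 0<λσ → nonpositive-balanced f-eigen 0<λσ balanced connected diameter v
    -- The goal is a negation, refuted by `contra`, so the eigenfunction vanishing at `x₀` is
    -- available although it exists only under a double negation.
    (inj₁ multiple) contra → eigenfunction-vanishing-at multiple x₀ λ (h , h-eigen , h≉0 , hx₀≈0) →
      bound h h-eigen h≉0 D (λ v _ → nonpositive-at-zero hx₀≈0 connected diameter v) contra
  where
  open RealNumbers R
  open OrderedField R
  open SignedGraph G
  open SignedLaplacian R G
  open Estimates R G
  open Eigenfunctions R G

  Q>0 : 0# < [2+ ε ]²-4/ N
  Q>0 = [2+ε]²-4/N-pos ε>0 N N-large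

  -- An endpoint of a pair realising the diameter; any vertex would do.
  x₀ : Fin n
  x₀ = proj₁ (proj₁ diameter)

  -- Common to all cases, which differ only in the eigenfunction and the admissible walk length `L`.
  bound : ∀ h → IsEigenfunction λσ h → ¬ (∀ x → h x ≈ 0#) → ∀ L →
    (∀ v → 0# < λσ → ¬ ¬ NonpositiveWithin h v L) →
    (ε / [2+ ε ]²-4/ N ⟨ Q>0 ⟩) * (1/ℕ (maxDegree *ℕ L *ℕ ⌈ L /2⌉))
      + ((fromℕ 2 * (fromℕ 2 + ε)) / [2+ ε ]²-4/ N ⟨ Q>0 ⟩) * K ≤ λσ
  bound h h-eigen h≉0 L near contra =
    ¬¬-maximum-square h x₀ h≉0 λ (v , 0<h²v , max) →
    nonneg⇒¬¬pos (eigenvalue-nonneg h-eigen 0<h²v max) λσ≉0 λ 0<λσ →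
    near v 0<λσ λ near-v →
    scaled-estimate ε>0 Q>0 (maxDegree *ℕ L *ℕ ⌈ L /2⌉)
      (eigenvalue-estimate h-eigen 0<h²v max ε>0 N cd 0<λσ near-v) contra
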